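{- Let $X$ be a weighted graph on $n$ vertices containing a vertex $u$ that has a twin, and let $M\in\{A(X),L(X),Q(X)\}$. If local $\epsilon$-uniform mixing occurs at $u$ in $X$ relative to $M$, then $n\le 4$.
   Context: Graphs are finite, simple, undirected and connected, with positive real edge weights. $A(X)$ is the weighted adjacency matrix, $D(X)$ is the diagonal matrix of vertex degrees (degree = sum of weights of incident edges), $L(X)=D(X)-A(X)$, $Q(X)=D(X)+A(X)$, and $U(t)=e^{\mathrm{i}tM}$. $\mathbf{e}_u$ is the characteristic vector of $u$, $\mathbf{1}$ the all-ones vector, $\circ$ the entrywise product. Local $\epsilon$-uniform mixing occurs at $u$ relative to $M$ if for each $\epsilon>0$ there is a time $\tau\in\mathbb{R}$ such that $\big\|(U(\tau)\mathbf{e}_u)\circ(\overline{U(\tau)}\mathbf{e}_u)-\tfrac1n\mathbf{1}\big\|<\epsilon$. Two distinct vertices $u$ and $v$ (adjacent or not) are twins in $X$ if $N(u)\setminus\{v\}=N(v)\setminus\{u\}$, where $N(\cdot)$ denotes the neighborhood, and the edges $\{u,w\}$ and $\{v,w\}$ have equal weights for all $w\in V(X)\setminus\{u,v\}$ adjacent to $u$ and $v$. -}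

module Defs where

open import Algebra.Bundles using (RawMonoid)
import Algebra.Definitions.RawMonoid as RawMonoidSum
open import Data.Bool using (true; false; if_then_else_)
open import Data.Fin using (Fin; zero; suc)
import Data.Fin as Fin
open import Data.Fin.Properties using (nonZeroIndex)
open import Data.Integer using (+_; -[1+_])
import Data.Integer as ℤ
import Data.Integer.Properties as ℤ
open import Data.Nat using (ℕ; zero; suc; _!)
import Data.Nat as ℕ
import Data.Nat.Properties as ℕ
open import Data.Product using (∃-syntax; _×_; _,_; proj₁; proj₂)
open import Data.Rational
open import Data.Rational.Properties
open import Data.Rational.Solver using (module +-*-Solver)
open import Data.Rational.Unnormalised using (mkℚᵘ; *≡*; *≤*) renaming (_≃_ to _≃ᵘ_; _*_ to _*ᵘ_)
import Data.Rational.Unnormalised.Properties as ℚᵘ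
open import Data.Sum using (_⊎_; inj₁; inj₂)
open import Data.Vec.Functional using (Vector)
open import Level using (0ℓ)
open import Relation.Binary using (Decidable; Symmetric)
open import Relation.Binary.Construct.Closure.ReflexiveTransitive using (Star)
open import Relation.Binary.PropositionalEquality
open import Relation.Nullary using (¬_; Dec; does; yes; no; contradiction)
open import Relation.Unary using (Pred; _∖_; _≐_; ｛_｝)

open +-*-Solver using (solve; _:+_; _:*_; _:-_; :-_; con; _:=_)

mulˡ-≤ : ∀ {r p q} → 0ℚ ≤ r → p ≤ q → r * p ≤ r * q
mulˡ-≤ {r} 0≤r = *-monoˡ-≤-nonNeg r {{nonNegative 0≤r}}

mulʳ-≤ : ∀ {r p q} → 0ℚ ≤ r → p ≤ q → p * r ≤ q * r
mulʳ-≤ {r} 0≤r = *-monoʳ-≤-nonNeg r {{nonNegative 0≤r}}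

mul-≤ : ∀ {p q r s} → 0ℚ ≤ p → 0ℚ ≤ s → p ≤ q → r ≤ s → p * r ≤ q * s
mul-≤ 0≤p 0≤s p≤q r≤s = ≤-trans (mulˡ-≤ 0≤p r≤s) (mulʳ-≤ 0≤s p≤q)

mulˡ-cancel-≤ : ∀ r p q → 0ℚ < r → r * p ≤ r * q → p ≤ q
mulˡ-cancel-≤ r p q 0<r = *-cancelˡ-≤-pos r {{positive 0<r}}

0≤* : ∀ {p q} → 0ℚ ≤ p → 0ℚ ≤ q → 0ℚ ≤ p * q
0≤* {p} {q} 0≤p 0≤q = ≤-trans (≤-reflexive (sym (*-zeroʳ p))) (mulˡ-≤ 0≤p 0≤q)

0≤+ : ∀ {p q} → 0ℚ ≤ p → 0ℚ ≤ q → 0ℚ ≤ p + q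
0≤+ 0≤p 0≤q = ≤-trans (≤-reflexive (sym (+-identityʳ 0ℚ))) (+-mono-≤ 0≤p 0≤q)

0<* : ∀ {p q} → 0ℚ < p → 0ℚ < q → 0ℚ < p * q
0<* {p} {q} 0<p 0<q =
  <-respˡ-≡ (*-zeroʳ p) (*-monoʳ-<-pos p {{positive 0<p}} 0<q)

0<½ : 0ℚ < ½
0<½ = positive⁻¹ ½

0<1 : 0ℚ < 1ℚ
0<1 = positive⁻¹ 1ℚ

0≤½ : 0ℚ ≤ ½
0≤½ = <⇒≤ 0<½

0<½* : ∀ {p} → 0ℚ < p → 0ℚ < ½ * p
0<½* = 0<* 0<½

half+half : ∀ p → ½ * p + ½ * p ≡ p
half+half = solve 1 (λ p → con ½ :* p :+ con ½ :* p := p) refl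

p≤p+q : ∀ p {q} → 0ℚ ≤ q → p ≤ p + q
p≤p+q p 0≤q = ≤-trans (≤-reflexive (sym (+-identityʳ p))) (+-monoʳ-≤ p 0≤q)

q≤p+q : ∀ {p} q → 0ℚ ≤ p → q ≤ p + q
q≤p+q {p} q 0≤p = ≤-trans (p≤p+q q 0≤p) (≤-reflexive (+-comm q p))

p≤∣p∣ : ∀ p → p ≤ ∣ p ∣
p≤∣p∣ p with ≤-total 0ℚ p
... | inj₁ 0≤p = ≤-reflexive (sym (0≤p⇒∣p∣≡p 0≤p))
... | inj₂ p≤0 = ≤-trans p≤0 (0≤∣p∣ p)

-p≤∣p∣ : ∀ p → - p ≤ ∣ p ∣
-p≤∣p∣ p = ≤-trans (p≤∣p∣ (- p)) (≤-reflexive (∣-p∣≡∣p∣ p))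

∣∣-≤ : ∀ {p c} → p ≤ c → - p ≤ c → ∣ p ∣ ≤ c
∣∣-≤ {p} p≤c -p≤c with ∣p∣≡p∨∣p∣≡-p p
... | inj₁ e = ≤-trans (≤-reflexive e) p≤c
... | inj₂ e = ≤-trans (≤-reflexive e) -p≤c

∣p-q∣≡∣q-p∣ : ∀ p q → ∣ p - q ∣ ≡ ∣ q - p ∣
∣p-q∣≡∣q-p∣ p q = trans (sym (∣-p∣≡∣p∣ (p - q)))
  (cong ∣_∣ (solve 2 (λ p q → :- (p :- q) := q :- p) refl p q))

triangle : ∀ p q r → ∣ p - r ∣ ≤ ∣ p - q ∣ + ∣ q - r ∣
triangle p q r = ≤-trans
  (≤-reflexive (cong ∣_∣ (solve 3 (λ p q r → p :- r := (p :- q) :+ (q :- r)) refl p q r)))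
  (∣p+q∣≤∣p∣+∣q∣ (p - q) (q - r))

p-q≤r⇒p≤q+r : ∀ {p q r} → p - q ≤ r → p ≤ q + r
p-q≤r⇒p≤q+r {p} {q} {r} h = ≤-trans
  (≤-reflexive (solve 2 (λ p q → p := q :+ (p :- q)) refl p q)) (+-monoʳ-≤ q h)

p≤q+r⇒p-q≤r : ∀ {p q r} → p ≤ q + r → p - q ≤ r
p≤q+r⇒p-q≤r {p} {q} {r} h = ≤-trans (+-monoˡ-≤ (- q) h)
  (≤-reflexive (solve 2 (λ q r → (q :+ r) :- q := r) refl q r))

∣p-q∣≤ : ∀ {p q r} → p ≤ q + r → q ≤ p + r → ∣ p - q ∣ ≤ r
∣p-q∣≤ {p} {q} {r} h₁ h₂ = ∣∣-≤ (p≤q+r⇒p-q≤r h₁)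
  (≤-trans (≤-reflexive (solve 2 (λ p q → :- (p :- q) := q :- p) refl p q)) (p≤q+r⇒p-q≤r h₂))

square-cancel-< : ∀ {p q} → 0ℚ ≤ q → p * p < q * q → p < q
square-cancel-< {p} {q} 0≤q h with q ≤? p
... | no q≰p = ≰⇒> q≰p
... | yes q≤p = contradiction
  (<-≤-trans h (mul-≤ 0≤q (≤-trans 0≤q q≤p) q≤p q≤p)) (<-irrefl refl)

opaque
  fromℕ : ℕ → ℚ
  fromℕ zero    = 0ℚ
  fromℕ (suc n) = 1ℚ + fromℕ n

  fromℕ-suc : ∀ n → fromℕ (suc n) ≡ 1ℚ + fromℕ n
  fromℕ-suc n = refl

  0≤fromℕ : ∀ n → 0ℚ ≤ fromℕ n
  0≤fromℕ zero    = ≤-refl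
  0≤fromℕ (suc n) = 0≤+ (<⇒≤ 0<1) (0≤fromℕ n)

  1≤fromℕ-suc : ∀ n → 1ℚ ≤ fromℕ (suc n)
  1≤fromℕ-suc n = p≤p+q 1ℚ (0≤fromℕ n)

  fromℕ-mono : ∀ {m n} → m ℕ.≤ n → fromℕ m ≤ fromℕ n
  fromℕ-mono {n = n} ℕ.z≤n = 0≤fromℕ n
  fromℕ-mono (ℕ.s≤s h)     = +-monoʳ-≤ 1ℚ (fromℕ-mono h)

  toℚᵘ-fromℕ : ∀ n → toℚᵘ (fromℕ n) ≃ᵘ mkℚᵘ (+ n) 0
  toℚᵘ-fromℕ zero    = *≡* refl
  toℚᵘ-fromℕ (suc n) = ℚᵘ.≃-trans (toℚᵘ-homo-+ 1ℚ (fromℕ n))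
    (ℚᵘ.≃-trans (ℚᵘ.+-congʳ (toℚᵘ 1ℚ) (toℚᵘ-fromℕ n)) (*≡* (cong (ℤ._* + 1) lem)))
    where
    lem : + 1 ℤ.* + 1 ℤ.+ + n ℤ.* + 1 ≡ + suc n
    lem = cong (λ z → + 1 ℤ.+ z) (ℤ.*-identityʳ (+ n))

≤fromℕ : ∀ q → ∃[ n ] q ≤ fromℕ n
≤fromℕ q@(mkℚ z d _) = ℤ.∣ z ∣ , toℚᵘ-cancel-≤
  (ℚᵘ.≤-respʳ-≃ (ℚᵘ.≃-sym (toℚᵘ-fromℕ ℤ.∣ z ∣)) (*≤* lem))
  where
  lem : z ℤ.* + 1 ℤ.≤ + ℤ.∣ z ∣ ℤ.* + suc d
  lem = ℤ.≤-trans (ℤ.≤-reflexive (ℤ.*-identityʳ z)) (ℤ.≤-trans (z≤∣z∣ z)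
    (ℤ.≤-trans (ℤ.+≤+ (ℕ.m≤m*n ℤ.∣ z ∣ (suc d))) (ℤ.≤-reflexive (ℤ.pos-* ℤ.∣ z ∣ (suc d)))))
    where
    z≤∣z∣ : ∀ z → z ℤ.≤ + ℤ.∣ z ∣
    z≤∣z∣ (+ n)    = ℤ.≤-refl
    z≤∣z∣ -[1+ n ] = ℤ.-≤+

opaque
  divide : ∀ {ε c} → 0ℚ < ε → 0ℚ < c → ∃[ δ ] (0ℚ < δ × c * δ ≡ ε)
  divide {ε} {c} 0<ε 0<c = 1/c * ε , 0<* (positive⁻¹ 1/c {{1/pos⇒pos c}}) 0<ε ,
    trans (sym (*-assoc c 1/c ε)) (trans (cong (_* ε) (*-inverseʳ c)) (*-identityˡ ε))
    where
    instance
      c-pos : Positive c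
      c-pos = positive 0<c
      c-nz : NonZero c
      c-nz = pos⇒nonZero c
    1/c : ℚ
    1/c = 1/ c

  archimedean : ∀ c {ε} → 0ℚ < ε → ∃[ n ] c ≤ fromℕ n * ε
  archimedean c {ε} 0<ε = n , ≤-trans (≤-reflexive e) (mulʳ-≤ (<⇒≤ 0<ε) h)
    where
    D : ∃[ δ ] (0ℚ < δ × ε * δ ≡ 1ℚ)
    D = divide 0<1 0<ε
    δ : ℚ
    δ = proj₁ D
    n : ℕ
    n = proj₁ (≤fromℕ (δ * c))
    h : δ * c ≤ fromℕ n
    h = proj₂ (≤fromℕ (δ * c))
    e : c ≡ δ * c * ε
    e = trans (sym (*-identityˡ c)) (trans (cong (_* c) (sym (proj₂ (proj₂ D))))
          (solve 3 (λ ε δ c → ε :* δ :* c := δ :* c :* ε) refl ε δ c))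

-- A nonnegative sequence whose terms at least halve tends to 0.
module Halving (w : ℕ → ℚ) (0≤w : ∀ k → 0ℚ ≤ w k) (w-half : ∀ k → w (suc k) ≤ ½ * w k) where

  step : ∀ {n x y z} → 1ℚ ≤ n → 0ℚ ≤ x → y ≤ ½ * x → n * x ≤ z → (1ℚ + n) * y ≤ z
  step {n} {x} {y} {z} 1≤n 0≤x y≤½x nx≤z = begin
    (1ℚ + n) * y              ≤⟨ mulˡ-≤ (0≤+ (<⇒≤ 0<1) (≤-trans (<⇒≤ 0<1) 1≤n)) y≤½x ⟩
    (1ℚ + n) * (½ * x)        ≡⟨ expand n x ⟩
    ½ * x + ½ * (n * x)       ≤⟨ +-monoˡ-≤ (½ * (n * x)) (mulˡ-≤ 0≤½ x≤nx) ⟩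
    ½ * (n * x) + ½ * (n * x) ≡⟨ half+half (n * x) ⟩
    n * x                     ≤⟨ nx≤z ⟩
    z                         ∎
    where
    open ≤-Reasoning
    expand : ∀ n x → (1ℚ + n) * (½ * x) ≡ ½ * x + ½ * (n * x)
    expand = solve 2 (λ n x → (con 1ℚ :+ n) :* (con ½ :* x) := con ½ :* x :+ con ½ :* (n :* x)) refl
    x≤nx : x ≤ n * x
    x≤nx = ≤-trans (≤-reflexive (sym (*-identityˡ x))) (mulʳ-≤ 0≤x 1≤n)

  opaque
    unfolding fromℕ

    weighted : ∀ k → fromℕ (suc k) * w k ≤ w 0
    weighted zero    = ≤-reflexive (*-identityˡ (w 0))
    weighted (suc k) = step {n = fromℕ (suc k)} {x = w k}
      (1≤fromℕ-suc k) (0≤w k) (w-half k) (weighted k)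

  →0 : ∀ {ε} → 0ℚ < ε → ∃[ K ] (∀ k → K ℕ.≤ k → w k ≤ ε)
  →0 {ε} 0<ε = let K , h = archimedean (w 0) 0<ε in K , λ k K≤k →
    mulˡ-cancel-≤ (fromℕ (suc k)) (w k) ε (<-≤-trans 0<1 (1≤fromℕ-suc k))
      (≤-trans (weighted k) (≤-trans h (mulʳ-≤ (<⇒≤ 0<ε) (fromℕ-mono (ℕ.m≤n⇒m≤1+n K≤k)))))

2⁻^_ : ℕ → ℚ
2⁻^ zero  = 1ℚ
2⁻^ suc k = ½ * 2⁻^ k

0<2⁻^ : ∀ k → 0ℚ < 2⁻^ k
0<2⁻^ zero    = 0<1
0<2⁻^ (suc k) = 0<½* (0<2⁻^ k)

c2⁻^→0 : ∀ c → 0ℚ ≤ c → ∀ {ε} → 0ℚ < ε → ∃[ K ] (∀ k → K ℕ.≤ k → c * 2⁻^ k ≤ ε)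
c2⁻^→0 c 0≤c = Halving.→0 (λ k → c * 2⁻^ k) (λ k → 0≤* 0≤c (<⇒≤ (0<2⁻^ k)))
  (λ k → ≤-reflexive (solve 2 (λ c x → c :* (con ½ :* x) := con ½ :* (c :* x)) refl c (2⁻^ k)))

invFact : ℕ → ℚ
invFact k = (+ 1 / (k !)) {{k ℕ.!≢0}}

invFact-pos : ∀ k → 0ℚ < invFact k
invFact-pos k = positive⁻¹ (invFact k) {{normalize-pos 1 (k !) {{k ℕ.!≢0}}}}

invFact-suc : ∀ k → fromℕ (suc k) * invFact (suc k) ≡ invFact k
invFact-suc k = toℚᵘ-injective (ℚᵘ.≃-trans (toℚᵘ-homo-* (fromℕ (suc k)) (invFact (suc k)))
  (ℚᵘ.≃-trans (ℚᵘ.*-cong (toℚᵘ-fromℕ (suc k)) (toℚᵘ-1/ (suc k !) {{suc k ℕ.!≢0}}))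
  (ℚᵘ.≃-trans lem (ℚᵘ.≃-sym (toℚᵘ-1/ (k !) {{k ℕ.!≢0}})))))
  where
  toℚᵘ-1/ : ∀ n .{{_ : ℕ.NonZero n}} → toℚᵘ (+ 1 / n) ≃ᵘ mkℚᵘ (+ 1) (ℕ.pred n)
  toℚᵘ-1/ (suc n) = toℚᵘ-fromℚᵘ (mkℚᵘ (+ 1) n)
  lem : mkℚᵘ (+ suc k) 0 *ᵘ mkℚᵘ (+ 1) (ℕ.pred (suc k !)) ≃ᵘ mkℚᵘ (+ 1) (ℕ.pred (k !))
  lem = *≡* (trans (cong₂ ℤ._*_ (ℤ.*-identityʳ (+ suc k)) (cong +_ (ℕ.suc-pred (k !) {{k ℕ.!≢0}})))
    (trans (sym (ℤ.pos-* (suc k) (k !))) (trans (cong +_ d≡) (sym (ℤ.*-identityˡ _)))))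
    where
    d≡ : suc k ! ≡ suc (ℕ.pred (suc k !) ℕ.+ 0)
    d≡ = sym (trans (cong suc (ℕ.+-identityʳ _)) (ℕ.suc-pred (suc k !) {{suc k ℕ.!≢0}}))

-- A real is a Cauchy sequence of rationals; equality of reals is _≈_.
IsCauchy : (ℕ → ℚ) → Set
IsCauchy x = ∀ ε → 0ℚ < ε → ∃[ N ] (∀ m n → N ℕ.≤ m → N ℕ.≤ n → ∣ x m - x n ∣ ≤ ε)

record ℝ : Set where
  constructor mkℝ
  field
    seq    : ℕ → ℚ
    cauchy : IsCauchy seq

open ℝ public

infix  4 _≈_ _≤ᴿ_ _<ᴿ_
infixl 6 _+ᴿ_ _-ᴿ_
infixl 7 _*ᴿ_
infix  8 -ᴿ_

_≈_ : ℝ → ℝ → Set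
x ≈ y = ∀ ε → 0ℚ < ε → ∃[ N ] (∀ n → N ℕ.≤ n → ∣ seq x n - seq y n ∣ ≤ ε)

_≤ᴿ_ : ℝ → ℝ → Set
x ≤ᴿ y = ∀ ε → 0ℚ < ε → ∃[ N ] (∀ n → N ℕ.≤ n → seq x n ≤ seq y n + ε)

_<ᴿ_ : ℝ → ℝ → Set
x <ᴿ y = ∃[ ε ] (0ℚ < ε × ∃[ N ] (∀ n → N ℕ.≤ n → seq x n + ε ≤ seq y n))

fromℚ : ℚ → ℝ
fromℚ q = mkℝ (λ _ → q) λ ε 0<ε → 0 , λ _ _ _ _ →
  ≤-trans (≤-reflexive (cong ∣_∣ (+-inverseʳ q))) (<⇒≤ 0<ε)

0ᴿ 1ᴿ : ℝ
0ᴿ = fromℚ 0ℚ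
1ᴿ = fromℚ 1ℚ

opaque
  maxAbs : (ℕ → ℚ) → ℕ → ℚ
  maxAbs x zero    = ∣ x zero ∣
  maxAbs x (suc N) = maxAbs x N ⊔ ∣ x (suc N) ∣

  ≤maxAbs : ∀ x N {i} → i ℕ.≤ N → ∣ x i ∣ ≤ maxAbs x N
  ≤maxAbs x zero    ℕ.z≤n = ≤-refl
  ≤maxAbs x (suc N) i≤1+N with ℕ.m≤n⇒m<n∨m≡n i≤1+N
  ... | inj₁ (ℕ.s≤s i≤N) = ≤-trans (≤maxAbs x N i≤N) (p≤p⊔q (maxAbs x N) _)
  ... | inj₂ refl        = p≤q⊔p (maxAbs x N) _

  bounded : ∀ x → IsCauchy x → ∃[ c ] (0ℚ < c × ∀ n → ∣ x n ∣ ≤ c)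
  bounded x x-cauchy = M + 1ℚ , 0<c , ≤c
    where
    N : ℕ
    N = proj₁ (x-cauchy 1ℚ 0<1)
    M : ℚ
    M = maxAbs x N
    0≤M : 0ℚ ≤ M
    0≤M = ≤-trans (0≤∣p∣ (x 0)) (≤maxAbs x N ℕ.z≤n)
    0<c : 0ℚ < M + 1ℚ
    0<c = <-≤-trans 0<1 (q≤p+q 1ℚ 0≤M)
    ≤c : ∀ n → ∣ x n ∣ ≤ M + 1ℚ
    ≤c n with ℕ.≤-total n N
    ... | inj₁ n≤N = ≤-trans (≤maxAbs x N n≤N) (p≤p+q M (<⇒≤ 0<1))
    ... | inj₂ N≤n = ≤-trans
      (≤-reflexive (cong ∣_∣ (solve 2 (λ p q → p := q :+ (p :- q)) refl (x n) (x N))))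
      (≤-trans (∣p+q∣≤∣p∣+∣q∣ (x N) (x n - x N))
        (+-mono-≤ (≤maxAbs x N ℕ.≤-refl) (proj₂ (x-cauchy 1ℚ 0<1) n N N≤n ℕ.≤-refl)))

  +-cauchy : ∀ x y → IsCauchy x → IsCauchy y → IsCauchy (λ n → x n + y n)
  +-cauchy x y cx cy ε 0<ε =
    let N₁ , h₁ = cx (½ * ε) (0<½* 0<ε)
        N₂ , h₂ = cy (½ * ε) (0<½* 0<ε)
    in N₁ ℕ.⊔ N₂ , λ m n N≤m N≤n → begin
      ∣ (x m + y m) - (x n + y n) ∣   ≡⟨ cong ∣_∣ (rearrange (x m) (y m) (x n) (y n)) ⟩
      ∣ (x m - x n) + (y m - y n) ∣   ≤⟨ ∣p+q∣≤∣p∣+∣q∣ (x m - x n) (y m - y n) ⟩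
      ∣ x m - x n ∣ + ∣ y m - y n ∣   ≤⟨ +-mono-≤
          (h₁ m n (ℕ.m⊔n≤o⇒m≤o N₁ N₂ N≤m) (ℕ.m⊔n≤o⇒m≤o N₁ N₂ N≤n))
          (h₂ m n (ℕ.m⊔n≤o⇒n≤o N₁ N₂ N≤m) (ℕ.m⊔n≤o⇒n≤o N₁ N₂ N≤n)) ⟩
      ½ * ε + ½ * ε                   ≡⟨ half+half ε ⟩
      ε                               ∎
    where
    open ≤-Reasoning
    rearrange : ∀ a b c d → (a + b) - (c + d) ≡ (a - c) + (b - d)
    rearrange = solve 4 (λ a b c d → (a :+ b) :- (c :+ d) := (a :- c) :+ (b :- d)) refl

  neg-cauchy : ∀ x → IsCauchy x → IsCauchy (λ n → - x n)
  neg-cauchy x cx ε 0<ε =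
    let N , h = cx ε 0<ε
    in N , λ m n N≤m N≤n → ≤-trans (≤-reflexive (e (x m) (x n))) (h m n N≤m N≤n)
    where
    e : ∀ a b → ∣ - a - - b ∣ ≡ ∣ a - b ∣
    e a b = trans (cong ∣_∣ (solve 2 (λ a b → :- a :- :- b := b :- a) refl a b)) (∣p-q∣≡∣q-p∣ b a)

  abs-cauchy : ∀ x → IsCauchy x → IsCauchy (λ n → ∣ x n ∣)
  abs-cauchy x cx ε 0<ε =
    let N , h = cx ε 0<ε
    in N , λ m n N≤m N≤n → ∣p-q∣≤ {∣ x m ∣} {∣ x n ∣} (bound (x m) (x n) (h m n N≤m N≤n)) (bound (x n) (x m) (h n m N≤n N≤m))
    where
    bound : ∀ a b → ∣ a - b ∣ ≤ ε → ∣ a ∣ ≤ ∣ b ∣ + ε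
    bound a b h = ≤-trans
      (≤-reflexive (cong ∣_∣ (solve 2 (λ a b → a := b :+ (a :- b)) refl a b)))
      (≤-trans (∣p+q∣≤∣p∣+∣q∣ b (a - b)) (+-monoʳ-≤ ∣ b ∣ h))

  *-cauchy : ∀ x y → IsCauchy x → IsCauchy y → IsCauchy (λ n → x n * y n)
  *-cauchy x y cx cy ε 0<ε = N₁ ℕ.⊔ N₂ , λ m n N≤m N≤n → begin
      ∣ x m * y m - x n * y n ∣   ≡⟨ cong ∣_∣ (rearrange (x m) (y m) (x n) (y n)) ⟩
      ∣ x m * (y m - y n) + (x m - x n) * y n ∣
                                  ≤⟨ ∣p+q∣≤∣p∣+∣q∣ (x m * (y m - y n)) ((x m - x n) * y n) ⟩
      ∣ x m * (y m - y n) ∣ + ∣ (x m - x n) * y n ∣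
                                  ≡⟨ cong₂ _+_ (∣p*q∣≡∣p∣*∣q∣ (x m) (y m - y n)) (∣p*q∣≡∣p∣*∣q∣ (x m - x n) (y n)) ⟩
      ∣ x m ∣ * ∣ y m - y n ∣ + ∣ x m - x n ∣ * ∣ y n ∣
                                  ≤⟨ +-mono-≤
          (mul-≤ (0≤∣p∣ (x m)) (<⇒≤ 0<δ₂) (≤c m) (h₂ m n (ℕ.m⊔n≤o⇒n≤o N₁ N₂ N≤m) (ℕ.m⊔n≤o⇒n≤o N₁ N₂ N≤n)))
          (mul-≤ (0≤∣p∣ (x m - x n)) (<⇒≤ 0<d) (h₁ m n (ℕ.m⊔n≤o⇒m≤o N₁ N₂ N≤m) (ℕ.m⊔n≤o⇒m≤o N₁ N₂ N≤n)) (≤d n)) ⟩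
      c * δ₂ + δ₁ * d             ≡⟨ cong₂ _+_ cδ₂ (trans (*-comm δ₁ d) dδ₁) ⟩
      ½ * ε + ½ * ε               ≡⟨ half+half ε ⟩
      ε                           ∎
    where
    open ≤-Reasoning
    rearrange : ∀ a b c d → a * b - c * d ≡ a * (b - d) + (a - c) * d
    rearrange = solve 4 (λ a b c d → a :* b :- c :* d := a :* (b :- d) :+ (a :- c) :* d) refl
    c d δ₁ δ₂ : ℚ
    c = proj₁ (bounded x cx)
    d = proj₁ (bounded y cy)
    0<c : 0ℚ < c
    0<c = proj₁ (proj₂ (bounded x cx))
    0<d : 0ℚ < d
    0<d = proj₁ (proj₂ (bounded y cy))
    ≤c : ∀ n → ∣ x n ∣ ≤ c
    ≤c = proj₂ (proj₂ (bounded x cx))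
    ≤d : ∀ n → ∣ y n ∣ ≤ d
    ≤d = proj₂ (proj₂ (bounded y cy))
    δ₂ = proj₁ (divide (0<½* 0<ε) 0<c)
    δ₁ = proj₁ (divide (0<½* 0<ε) 0<d)
    0<δ₂ : 0ℚ < δ₂
    0<δ₂ = proj₁ (proj₂ (divide (0<½* 0<ε) 0<c))
    0<δ₁ : 0ℚ < δ₁
    0<δ₁ = proj₁ (proj₂ (divide (0<½* 0<ε) 0<d))
    cδ₂ : c * δ₂ ≡ ½ * ε
    cδ₂ = proj₂ (proj₂ (divide (0<½* 0<ε) 0<c))
    dδ₁ : d * δ₁ ≡ ½ * ε
    dδ₁ = proj₂ (proj₂ (divide (0<½* 0<ε) 0<d))
    N₁ N₂ : ℕ
    N₁ = proj₁ (cx δ₁ 0<δ₁)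
    N₂ = proj₁ (cy δ₂ 0<δ₂)
    h₁ : ∀ m n → N₁ ℕ.≤ m → N₁ ℕ.≤ n → ∣ x m - x n ∣ ≤ δ₁
    h₁ = proj₂ (cx δ₁ 0<δ₁)
    h₂ : ∀ m n → N₂ ℕ.≤ m → N₂ ℕ.≤ n → ∣ y m - y n ∣ ≤ δ₂
    h₂ = proj₂ (cy δ₂ 0<δ₂)

_+ᴿ_ : ℝ → ℝ → ℝ
x +ᴿ y = mkℝ (λ n → seq x n + seq y n) (+-cauchy (seq x) (seq y) (cauchy x) (cauchy y))

-ᴿ_ : ℝ → ℝ
-ᴿ x = mkℝ (λ n → - seq x n) (neg-cauchy (seq x) (cauchy x))

_-ᴿ_ : ℝ → ℝ → ℝ
x -ᴿ y = x +ᴿ (-ᴿ y)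

_*ᴿ_ : ℝ → ℝ → ℝ
x *ᴿ y = mkℝ (λ n → seq x n * seq y n) (*-cauchy (seq x) (seq y) (cauchy x) (cauchy y))

∣_∣ᴿ : ℝ → ℝ
∣ x ∣ᴿ = mkℝ (λ n → ∣ seq x n ∣) (abs-cauchy (seq x) (cauchy x))

+ᴿ-rawMonoid : RawMonoid 0ℓ 0ℓ
+ᴿ-rawMonoid = record { Carrier = ℝ ; _≈_ = _≈_ ; _∙_ = _+ᴿ_ ; ε = 0ᴿ }

sumᴿ : ∀ {n} → Vector ℝ n → ℝ
sumᴿ = RawMonoidSum.sum +ᴿ-rawMonoid

IsCauchyᴿ : (ℕ → ℝ) → Set
IsCauchyᴿ s = ∀ ε → 0ℚ < ε → ∃[ N ] (∀ m n → N ℕ.≤ m → N ℕ.≤ n → ∣ s m -ᴿ s n ∣ᴿ ≤ᴿ fromℚ ε)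

-- The n-th term of the limit approximates s n to within 2⁻ⁿ.
limSeq : (ℕ → ℝ) → ℕ → ℚ
limSeq s n = seq (s n) (proj₁ (cauchy (s n) (2⁻^ n) (0<2⁻^ n)))

opaque
  limSeq-approx : ∀ s n → ∃[ N ] (∀ k → N ℕ.≤ k → ∣ limSeq s n - seq (s n) k ∣ ≤ 2⁻^ n)
  limSeq-approx s n =
    let N , h = cauchy (s n) (2⁻^ n) (0<2⁻^ n)
    in N , λ k N≤k → h N k ℕ.≤-refl N≤k

  lim-cauchy : ∀ s → IsCauchyᴿ s → IsCauchy (limSeq s)
  lim-cauchy s s-cauchy ε 0<ε =
    let ε′ = ½ * (½ * ε)
        0<ε′ = 0<½* (0<½* 0<ε)
        N₁ , h₁ = s-cauchy ε′ 0<ε′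
        N₂ , h₂ = c2⁻^→0 1ℚ (<⇒≤ 0<1) 0<ε′
        small : ∀ k → N₂ ℕ.≤ k → 2⁻^ k ≤ ε′
        small k N₂≤k = ≤-trans (≤-reflexive (sym (*-identityˡ (2⁻^ k)))) (h₂ k N₂≤k)
    in N₁ ℕ.⊔ N₂ , λ m n N≤m N≤n →
      let Kₘ , aₘ = limSeq-approx s m
          Kₙ , aₙ = limSeq-approx s n
          K  , b  = h₁ m n (ℕ.m⊔n≤o⇒m≤o N₁ N₂ N≤m) (ℕ.m⊔n≤o⇒m≤o N₁ N₂ N≤n) ε′ 0<ε′
          k = Kₘ ℕ.⊔ (Kₙ ℕ.⊔ K)
          k′≤k = ℕ.m≤n⊔m Kₘ (Kₙ ℕ.⊔ K)
      in combine (limSeq s m) (seq (s m) k) (seq (s n) k) (limSeq s n)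
           (≤-trans (aₘ k (ℕ.m≤m⊔n Kₘ _)) (small m (ℕ.m⊔n≤o⇒n≤o N₁ N₂ N≤m)))
           (b k (ℕ.≤-trans (ℕ.m≤n⊔m Kₙ K) k′≤k))
           (≤-trans (aₙ k (ℕ.≤-trans (ℕ.m≤m⊔n Kₙ K) k′≤k)) (small n (ℕ.m⊔n≤o⇒n≤o N₁ N₂ N≤n)))
    where
    quarters : ∀ ε → ½ * (½ * ε) + (½ * (½ * ε) + ½ * (½ * ε) + ½ * (½ * ε)) ≡ ε
    quarters = solve 1 (λ ε → con ½ :* (con ½ :* ε) :+ (con ½ :* (con ½ :* ε) :+ con ½ :* (con ½ :* ε) :+ con ½ :* (con ½ :* ε)) := ε) refl
    combine : ∀ p q r t → ∣ p - q ∣ ≤ ½ * (½ * ε) → ∣ q - r ∣ ≤ ½ * (½ * ε) + ½ * (½ * ε) →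
              ∣ t - r ∣ ≤ ½ * (½ * ε) → ∣ p - t ∣ ≤ ε
    combine p q r t h₁ h₂ h₃ = ≤-trans (triangle p q t)
      (≤-trans (+-mono-≤ h₁ (≤-trans (triangle q r t)
        (+-mono-≤ h₂ (≤-trans (≤-reflexive (∣p-q∣≡∣q-p∣ r t)) h₃))))
        (≤-reflexive (quarters ε)))

lim : (s : ℕ → ℝ) → IsCauchyᴿ s → ℝ
lim s s-cauchy = mkℝ (limSeq s) (lim-cauchy s s-cauchy)

opaque
  lim-converges : ∀ s (s-cauchy : IsCauchyᴿ s) ε → 0ℚ < ε →
    ∃[ N ] (∀ n → N ℕ.≤ n → ∣ s n -ᴿ lim s s-cauchy ∣ᴿ ≤ᴿ fromℚ ε)
  lim-converges s s-cauchy ε 0<ε =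
    let N , h = s-cauchy ε 0<ε
    in N , λ n N≤n δ 0<δ →
      let δ′ = ½ * (½ * δ)
          0<δ′ = 0<½* (0<½* 0<δ)
          K₁ , h₁ = c2⁻^→0 1ℚ (<⇒≤ 0<1) 0<δ′
          K₂ , h₂ = cauchy (s n) δ′ 0<δ′
          K = N ℕ.⊔ (K₁ ℕ.⊔ K₂)
          K₁₂≤K = ℕ.m≤n⊔m N (K₁ ℕ.⊔ K₂)
      in K , λ k K≤k →
        let L₁ , a₁ = limSeq-approx s k
            L₂ , a₂ = h n k N≤n (ℕ.≤-trans (ℕ.m≤m⊔n N (K₁ ℕ.⊔ K₂)) K≤k) δ′ 0<δ′
            K₁≤k = ℕ.≤-trans (ℕ.≤-trans (ℕ.m≤m⊔n K₁ K₂) K₁₂≤K) K≤k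
            K₂≤k = ℕ.≤-trans (ℕ.≤-trans (ℕ.m≤n⊔m K₁ K₂) K₁₂≤K) K≤k
            l = k ℕ.⊔ (L₁ ℕ.⊔ L₂)
            L≤l = ℕ.m≤n⊔m k (L₁ ℕ.⊔ L₂)
        in combine δ 0<δ (seq (s n) k) (seq (s n) l) (seq (s k) l) (limSeq s k)
             (h₂ k l K₂≤k (ℕ.≤-trans K₂≤k (ℕ.m≤m⊔n k (L₁ ℕ.⊔ L₂))))
             (a₂ l (ℕ.≤-trans (ℕ.m≤n⊔m L₁ L₂) L≤l))
             (≤-trans (a₁ l (ℕ.≤-trans (ℕ.m≤m⊔n L₁ L₂) L≤l))
               (≤-trans (≤-reflexive (sym (*-identityˡ (2⁻^ k)))) (h₁ k K₁≤k)))
    where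
    quarters : ∀ ε δ → ½ * (½ * δ) + (ε + ½ * (½ * δ) + ½ * (½ * δ)) + ½ * (½ * δ) ≡ ε + δ
    quarters = solve 2 (λ ε δ → con ½ :* (con ½ :* δ) :+ (ε :+ con ½ :* (con ½ :* δ) :+ con ½ :* (con ½ :* δ)) :+ con ½ :* (con ½ :* δ) := ε :+ δ) refl
    combine : ∀ δ → 0ℚ < δ → ∀ p q r t → ∣ p - q ∣ ≤ ½ * (½ * δ) → ∣ q - r ∣ ≤ ε + ½ * (½ * δ) →
              ∣ t - r ∣ ≤ ½ * (½ * δ) → ∣ p - t ∣ ≤ ε + δ
    combine δ 0<δ p q r t h₁ h₂ h₃ = ≤-trans (triangle p q t)
      (≤-trans (+-mono-≤ h₁ (≤-trans (triangle q r t)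
        (+-mono-≤ h₂ (≤-trans (≤-reflexive (∣p-q∣≡∣q-p∣ r t)) h₃))))
        (≤-trans (p≤p+q _ (<⇒≤ (0<½* (0<½* 0<δ)))) (≤-reflexive (quarters ε δ))))

-- Bisection for √q on [0 , ∣ q ∣ + 1]: after k steps the root lies in
-- [ root q k , root q k + width q k ).
width : ℚ → ℕ → ℚ
width q k = (∣ q ∣ + 1ℚ) * 2⁻^ k

choose : {P : Set} → Dec P → ℚ → ℚ → ℚ
choose (yes _) s r = s
choose (no  _) s r = r

root : ℚ → ℕ → ℚ
root q zero    = 0ℚ
root q (suc k) = choose (s * s ≤? q) s (root q k)
  where
  s : ℚ
  s = root q k + width q (suc k)

opaque
  0<∣q∣+1 : ∀ q → 0ℚ < ∣ q ∣ + 1ℚ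
  0<∣q∣+1 q = <-≤-trans 0<1 (q≤p+q 1ℚ (0≤∣p∣ q))

  0≤width : ∀ q k → 0ℚ ≤ width q k
  0≤width q k = 0≤* {∣ q ∣ + 1ℚ} (<⇒≤ (0<∣q∣+1 q)) (<⇒≤ (0<2⁻^ k))

  0≤choose : ∀ {P} (d : Dec P) s r → 0ℚ ≤ s → 0ℚ ≤ r → 0ℚ ≤ choose d s r
  0≤choose (yes _) s r 0≤s 0≤r = 0≤s
  0≤choose (no  _) s r 0≤s 0≤r = 0≤r

  choose-lower : ∀ q s r (d : Dec (s * s ≤ q)) → r ≡ 0ℚ ⊎ r * r ≤ q →
                 choose d s r ≡ 0ℚ ⊎ choose d s r * choose d s r ≤ q
  choose-lower q s r (yes h) _ = inj₂ h
  choose-lower q s r (no  _) h = h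

  choose-upper : ∀ q r w (d : Dec ((r + w) * (r + w) ≤ q)) → q < (r + w + w) * (r + w + w) →
                 q < (choose d (r + w) r + w) * (choose d (r + w) r + w)
  choose-upper q r w (yes _) h = h
  choose-upper q r w (no s≰) _ = ≰⇒> s≰

  0≤root : ∀ q k → 0ℚ ≤ root q k
  0≤root q zero    = ≤-refl
  0≤root q (suc k) = 0≤choose ((root q k + width q (suc k)) * (root q k + width q (suc k)) ≤? q)
    (root q k + width q (suc k)) (root q k)
    (0≤+ {root q k} (0≤root q k) (0≤width q (suc k))) (0≤root q k)

  root-lower : ∀ q k → root q k ≡ 0ℚ ⊎ root q k * root q k ≤ q
  root-lower q zero    = inj₁ refl
  root-lower q (suc k) = choose-lower q (root q k + width q (suc k)) (root q k)
    ((root q k + width q (suc k)) * (root q k + width q (suc k)) ≤? q) (root-lower q k)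

  root-upper : ∀ q k → q < (root q k + width q k) * (root q k + width q k)
  root-upper q zero = ≤-<-trans (p≤∣p∣ q) (<-≤-trans lt (≤-reflexive (e ∣ q ∣)))
    where
    lt : ∣ q ∣ < ∣ q ∣ + 1ℚ + (∣ q ∣ * ∣ q ∣ + ∣ q ∣)
    lt = <-≤-trans (<-respˡ-≡ (+-identityʳ ∣ q ∣) (+-monoʳ-< ∣ q ∣ 0<1))
      (p≤p+q (∣ q ∣ + 1ℚ) (0≤+ {∣ q ∣ * ∣ q ∣} (0≤* {∣ q ∣} (0≤∣p∣ q) (0≤∣p∣ q)) (0≤∣p∣ q)))
    e : ∀ a → a + 1ℚ + (a * a + a) ≡ (0ℚ + (a + 1ℚ) * 1ℚ) * (0ℚ + (a + 1ℚ) * 1ℚ)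
    e = solve 1 (λ a → a :+ con 1ℚ :+ (a :* a :+ a) := (con 0ℚ :+ (a :+ con 1ℚ) :* con 1ℚ) :* (con 0ℚ :+ (a :+ con 1ℚ) :* con 1ℚ)) refl
  root-upper q (suc k) = choose-upper q (root q k) (width q (suc k))
    ((root q k + width q (suc k)) * (root q k + width q (suc k)) ≤? q)
    (<-≤-trans (root-upper q k) (≤-reflexive (cong (λ z → z * z) (e (root q k) (∣ q ∣ + 1ℚ) (2⁻^ k)))))
    where
    e : ∀ r a x → r + a * x ≡ r + a * (½ * x) + a * (½ * x)
    e = solve 3 (λ r a x → r :+ a :* x := r :+ a :* (con ½ :* x) :+ a :* (con ½ :* x)) refl

  root-close : ∀ {p q η} k m → 0ℚ < η → p ≤ q + η * η → root p k ≤ root q m + width q m + η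
  root-close {p} {q} {η} k m 0<η p≤ with root-lower p k
  ... | inj₁ r≡0 = ≤-trans (≤-reflexive r≡0) (0≤+ {root q m + width q m} (0≤+ {root q m} (0≤root q m) (0≤width q m)) (<⇒≤ 0<η))
  ... | inj₂ r²≤p = <⇒≤ (square-cancel-< (0≤+ {s} 0≤s (<⇒≤ 0<η))
        (≤-<-trans r²≤p (≤-<-trans p≤ (<-≤-trans (+-monoˡ-< (η * η) (root-upper q m)) (sq≤ s 0≤s)))))
    where
    s : ℚ
    s = root q m + width q m
    0≤s : 0ℚ ≤ s
    0≤s = 0≤+ {root q m} (0≤root q m) (0≤width q m)
    e : ∀ s η → s * s + η * η + (s * η + s * η) ≡ (s + η) * (s + η)
    e = solve 2 (λ s η → s :* s :+ η :* η :+ (s :* η :+ s :* η) := (s :+ η) :* (s :+ η)) refl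
    sq≤ : ∀ s → 0ℚ ≤ s → s * s + η * η ≤ (s + η) * (s + η)
    sq≤ s 0≤s = ≤-trans (p≤p+q (s * s + η * η) (0≤+ {s * η} (0≤* {s} 0≤s (<⇒≤ 0<η)) (0≤* {s} 0≤s (<⇒≤ 0<η))))
      (≤-reflexive (e s η))

  sqrt-cauchy : ∀ x → IsCauchy x → IsCauchy (λ k → root (x k) k)
  sqrt-cauchy x cx ε 0<ε =
    let c , 0<c , ≤c = bounded x cx
        N₁ , h₁ = cx (η * η) (0<* {η} 0<η 0<η)
        N₂ , h₂ = c2⁻^→0 (c + 1ℚ) (0≤+ {c} (<⇒≤ 0<c) (<⇒≤ 0<1)) 0<η
        w≤ : ∀ m → N₂ ℕ.≤ m → width (x m) m ≤ η
        w≤ m N₂≤m = ≤-trans (mulʳ-≤ (<⇒≤ (0<2⁻^ m)) (+-monoˡ-≤ 1ℚ (≤c m))) (h₂ m N₂≤m)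
        half : ∀ k m → N₁ ℕ.⊔ N₂ ℕ.≤ k → N₁ ℕ.⊔ N₂ ℕ.≤ m → root (x k) k ≤ root (x m) m + ε
        half k m N≤k N≤m = bound (root (x k) k) (root (x m) m) (width (x m) m)
          (root-close {x k} {x m} k m 0<η (p-q≤r⇒p≤q+r {x k} {x m} (≤-trans (p≤∣p∣ (x k - x m))
            (h₁ k m (ℕ.m⊔n≤o⇒m≤o N₁ N₂ N≤k) (ℕ.m⊔n≤o⇒m≤o N₁ N₂ N≤m)))))
          (w≤ m (ℕ.m⊔n≤o⇒n≤o N₁ N₂ N≤m))
    in N₁ ℕ.⊔ N₂ , λ m n N≤m N≤n → ∣p-q∣≤ {root (x m) m} {root (x n) n} (half m n N≤m N≤n) (half n m N≤n N≤m)
    where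
    η : ℚ
    η = ½ * ε
    0<η : 0ℚ < η
    0<η = 0<½* 0<ε
    bound : ∀ p r w → p ≤ r + w + η → w ≤ η → p ≤ r + ε
    bound p r w p≤ w≤η = ≤-trans p≤ (≤-trans (+-monoˡ-≤ η (+-monoʳ-≤ r w≤η))
      (≤-reflexive (trans (+-assoc r η η) (cong (λ z → r + z) (half+half ε)))))

-- √x for x ≥ 0; the value is 0 for x ≤ 0.
sqrt : ℝ → ℝ
sqrt x = mkℝ (λ k → root (seq x k) k) (sqrt-cauchy (seq x) (cauchy x))

opaque
  sqrt-square : ∀ x → 0ᴿ ≤ᴿ x → sqrt x *ᴿ sqrt x ≈ x
  sqrt-square x 0≤x ε 0<ε =
    let c , 0<c , ≤c = bounded (seq x) (cauchy x)
        C = c + 1ℚ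
        0<C = <-≤-trans 0<1 (q≤p+q 1ℚ (<⇒≤ 0<c))
        D = C * C + C * C + C * C
        0≤CC = 0≤* {C} (<⇒≤ 0<C) (<⇒≤ 0<C)
        N₁ , h₁ = 0≤x ε 0<ε
        N₂ , h₂ = c2⁻^→0 D (0≤+ {C * C + C * C} (0≤+ {C * C} 0≤CC 0≤CC) 0≤CC) 0<ε
    in N₁ ℕ.⊔ N₂ , λ k N≤k →
      let q = seq x k
          r = root q k
          N₁≤k = ℕ.m⊔n≤o⇒m≤o N₁ N₂ N≤k
          N₂≤k = ℕ.m⊔n≤o⇒n≤o N₁ N₂ N≤k
          w≤ = mulʳ-≤ (<⇒≤ (0<2⁻^ k)) (+-monoˡ-≤ 1ℚ (≤c k))
      in ∣p-q∣≤ {r * r} {q} (lower q r (root-lower q k) (h₁ k N₁≤k))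
           (≤-trans (<⇒≤ (root-upper q k)) (≤-trans (≤-reflexive (expand r (width q k)))
             (+-monoʳ-≤ (r * r) (≤-trans
               (upper C r (width q k) (2⁻^ k) (<⇒≤ 0<C) (0≤width q k) (0≤2⁻^ k) (2⁻^≤1 k)
                 (root≤ c q r (<⇒≤ 0<c) (≤-trans (p≤∣p∣ q) (≤c k)) (root-lower q k)) w≤)
               (h₂ k N₂≤k)))))
    where
    0≤2⁻^ : ∀ k → 0ℚ ≤ 2⁻^ k
    0≤2⁻^ k = <⇒≤ (0<2⁻^ k)
    2⁻^≤1 : ∀ k → 2⁻^ k ≤ 1ℚ
    2⁻^≤1 zero    = ≤-refl
    2⁻^≤1 (suc k) = ≤-trans (p≤p+q (½ * 2⁻^ k) (0≤* {½} 0≤½ (0≤2⁻^ k)))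
      (≤-trans (≤-reflexive (half+half (2⁻^ k))) (2⁻^≤1 k))
    lower : ∀ q r → r ≡ 0ℚ ⊎ r * r ≤ q → 0ℚ ≤ q + ε → r * r ≤ q + ε
    lower q r (inj₁ refl) h = h
    lower q r (inj₂ h)    _ = ≤-trans h (p≤p+q q (<⇒≤ 0<ε))
    expand : ∀ r w → (r + w) * (r + w) ≡ r * r + (r + r + w) * w
    expand = solve 2 (λ r w → (r :+ w) :* (r :+ w) := r :* r :+ (r :+ r :+ w) :* w) refl
    root≤ : ∀ c q r → 0ℚ ≤ c → q ≤ c → r ≡ 0ℚ ⊎ r * r ≤ q → r ≤ c + 1ℚ
    root≤ c q r 0≤c q≤c (inj₁ refl) = 0≤+ {c} 0≤c (<⇒≤ 0<1)
    root≤ c q r 0≤c q≤c (inj₂ h)    = <⇒≤ (square-cancel-< {r} {c + 1ℚ} (0≤+ {c} 0≤c (<⇒≤ 0<1))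
      (≤-<-trans h (≤-<-trans q≤c (<-≤-trans lt (≤-reflexive (e c))))))
      where
      lt : c < c + 1ℚ + (c * c + c)
      lt = <-≤-trans (<-respˡ-≡ (+-identityʳ c) (+-monoʳ-< c 0<1))
        (p≤p+q (c + 1ℚ) (0≤+ {c * c} (0≤* {c} 0≤c 0≤c) 0≤c))
      e : ∀ c → c + 1ℚ + (c * c + c) ≡ (c + 1ℚ) * (c + 1ℚ)
      e = solve 1 (λ c → c :+ con 1ℚ :+ (c :* c :+ c) := (c :+ con 1ℚ) :* (c :+ con 1ℚ)) refl
    upper : ∀ C r w t → 0ℚ ≤ C → 0ℚ ≤ w → 0ℚ ≤ t → t ≤ 1ℚ → r ≤ C → w ≤ C * t →
            (r + r + w) * w ≤ (C * C + C * C + C * C) * t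
    upper C r w t 0≤C 0≤w 0≤t t≤1 r≤C w≤Ct = ≤-trans
      (mulʳ-≤ {w} {r + r + w} {C + C + C} 0≤w (+-mono-≤ (+-mono-≤ r≤C r≤C) w≤C))
      (≤-trans (mulˡ-≤ {C + C + C} (0≤+ {C + C} (0≤+ {C} 0≤C 0≤C) 0≤C) w≤Ct) (≤-reflexive (e C t)))
      where
      w≤C : w ≤ C
      w≤C = ≤-trans w≤Ct (≤-trans (mulˡ-≤ {C} 0≤C t≤1) (≤-reflexive (*-identityʳ C)))
      e : ∀ C t → (C + C + C) * (C * t) ≡ (C * C + C * C + C * C) * t
      e = solve 2 (λ C t → (C :+ C :+ C) :* (C :* t) := (C :* C :+ C :* C :+ C :* C) :* t) refl

record ℂ : Set where
  constructor _+i_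
  field
    re im : ℝ

open ℂ public

infix  5 _+i_
infixl 6 _+ᶜ_ _-ᶜ_
infixl 7 _*ᶜ_

0ᶜ 1ᶜ 𝕚 : ℂ
0ᶜ = 0ᴿ +i 0ᴿ
1ᶜ = 1ᴿ +i 0ᴿ
𝕚  = 0ᴿ +i 1ᴿ

fromℝ : ℝ → ℂ
fromℝ x = x +i 0ᴿ

_+ᶜ_ _-ᶜ_ _*ᶜ_ : ℂ → ℂ → ℂ
z +ᶜ w = (re z +ᴿ re w) +i (im z +ᴿ im w)
z -ᶜ w = (re z -ᴿ re w) +i (im z -ᴿ im w)
z *ᶜ w = (re z *ᴿ re w -ᴿ im z *ᴿ im w) +i (re z *ᴿ im w +ᴿ im z *ᴿ re w)

conj : ℂ → ℂ
conj z = re z +i (-ᴿ im z)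

∣_∣² : ℂ → ℝ
∣ z ∣² = re z *ᴿ re z +ᴿ im z *ᴿ im z

+ᶜ-rawMonoid : RawMonoid 0ℓ 0ℓ
+ᶜ-rawMonoid = record
  { Carrier = ℂ ; _≈_ = λ z w → re z ≈ re w × im z ≈ im w ; _∙_ = _+ᶜ_ ; ε = 0ᶜ }

sumᶜ : ∀ {n} → Vector ℂ n → ℂ
sumᶜ = RawMonoidSum.sum +ᶜ-rawMonoid

Matrix : Set → ℕ → Set
Matrix K n = Fin n → Fin n → K

infixl 7 _⊗_ _⊗ᵛ_ _∘ᵛ_
infixl 6 _-ᵛ_

identity : ∀ {n} → Matrix ℂ n
identity i j = if does (i Fin.≟ j) then 1ᶜ else 0ᶜ

_⊗_ : ∀ {n} → Matrix ℂ n → Matrix ℂ n → Matrix ℂ n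
(B ⊗ C) i j = sumᶜ λ k → B i k *ᶜ C k j

_⊗ᵛ_ : ∀ {n} → Matrix ℂ n → Vector ℂ n → Vector ℂ n
(B ⊗ᵛ x) i = sumᶜ λ k → B i k *ᶜ x k

power : ∀ {n} → Matrix ℂ n → ℕ → Matrix ℂ n
power B zero    = identity
power B (suc k) = B ⊗ power B k

conjᵐ : ∀ {n} → Matrix ℂ n → Matrix ℂ n
conjᵐ B i j = conj (B i j)

𝐞 : ∀ {n} → Fin n → Vector ℂ n
𝐞 u v = if does (u Fin.≟ v) then 1ᶜ else 0ᶜ

_∘ᵛ_ _-ᵛ_ : ∀ {n} → Vector ℂ n → Vector ℂ n → Vector ℂ n
(x ∘ᵛ y) v = x v *ᶜ y v
(x -ᵛ y) v = x v -ᶜ y v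

‖_‖ : ∀ {n} → Vector ℂ n → ℝ
‖ x ‖ = sqrt (sumᴿ λ v → ∣ x v ∣²)

-- Σ_{k < N} Bᵏ / k!
expSum : ∀ {n} → Matrix ℂ n → ℕ → Matrix ℂ n
expSum B zero    i j = 0ᶜ
expSum B (suc N) i j = expSum B N i j +ᶜ fromℝ (fromℚ (invFact N)) *ᶜ power B N i j

powℚ : ℚ → ℕ → ℚ
powℚ R zero    = 1ℚ
powℚ R (suc k) = R * powℚ R k

-- Bounds valid at every index of the representing sequences.
Boundᴿ : ℚ → ℝ → Set
Boundᴿ c x = ∀ k → ∣ seq x k ∣ ≤ c

Boundᶜ : ℚ → ℂ → Set
Boundᶜ c z = Boundᴿ c (re z) × Boundᴿ c (im z)

opaque
  bound-mono : ∀ {c d z} → c ≤ d → Boundᶜ c z → Boundᶜ d z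
  bound-mono c≤d (a , b) = (λ k → ≤-trans (a k) c≤d) , (λ k → ≤-trans (b k) c≤d)

  bound-+ : ∀ {c d} z w → Boundᶜ c z → Boundᶜ d w → Boundᶜ (c + d) (z +ᶜ w)
  bound-+ z w (a , b) (a′ , b′) =
    (λ k → ≤-trans (∣p+q∣≤∣p∣+∣q∣ (seq (re z) k) (seq (re w) k)) (+-mono-≤ (a k) (a′ k))) ,
    (λ k → ≤-trans (∣p+q∣≤∣p∣+∣q∣ (seq (im z) k) (seq (im w) k)) (+-mono-≤ (b k) (b′ k)))

  ∣p*q∣≤ : ∀ {c d} p q → 0ℚ ≤ d → ∣ p ∣ ≤ c → ∣ q ∣ ≤ d → ∣ p * q ∣ ≤ c * d
  ∣p*q∣≤ p q 0≤d p≤c q≤d = ≤-trans (≤-reflexive (∣p*q∣≡∣p∣*∣q∣ p q)) (mul-≤ (0≤∣p∣ p) 0≤d p≤c q≤d)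

  bound-* : ∀ {c d} z w → 0ℚ ≤ d → Boundᶜ c z → Boundᶜ d w → Boundᶜ (c * d + c * d) (z *ᶜ w)
  bound-* z w 0≤d (a , b) (a′ , b′) =
    (λ k → ≤-trans (∣p-q∣≤∣p∣+∣q∣ (seq (re z) k * seq (re w) k) (seq (im z) k * seq (im w) k))
      (+-mono-≤ (∣p*q∣≤ (seq (re z) k) (seq (re w) k) 0≤d (a k) (a′ k))
                (∣p*q∣≤ (seq (im z) k) (seq (im w) k) 0≤d (b k) (b′ k)))) ,
    (λ k → ≤-trans (∣p+q∣≤∣p∣+∣q∣ (seq (re z) k * seq (im w) k) (seq (im z) k * seq (re w) k))
      (+-mono-≤ (∣p*q∣≤ (seq (re z) k) (seq (im w) k) 0≤d (a k) (b′ k))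
                (∣p*q∣≤ (seq (im z) k) (seq (re w) k) 0≤d (b k) (a′ k))))

  bound-real* : ∀ {q d} z → 0ℚ ≤ q → 0ℚ ≤ d → Boundᶜ d z → Boundᶜ (d * q) (fromℝ (fromℚ q) *ᶜ z)
  bound-real* {q} {d} z 0≤q 0≤d (a , b) =
    (λ k → ≤-trans (≤-reflexive (cong ∣_∣ (e₁ q (seq (re z) k) (seq (im z) k)))) (bnd (seq (re z) k) (a k))) ,
    (λ k → ≤-trans (≤-reflexive (cong ∣_∣ (e₂ q (seq (re z) k) (seq (im z) k)))) (bnd (seq (im z) k) (b k)))
    where
    e₁ : ∀ q x y → q * x - 0ℚ * y ≡ x * q
    e₁ = solve 3 (λ q x y → q :* x :- con 0ℚ :* y := x :* q) refl
    e₂ : ∀ q x y → q * y + 0ℚ * x ≡ y * q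
    e₂ = solve 3 (λ q x y → q :* y :+ con 0ℚ :* x := y :* q) refl
    bnd : ∀ x → ∣ x ∣ ≤ d → ∣ x * q ∣ ≤ d * q
    bnd x x≤d = ∣p*q∣≤ x q 0≤q x≤d (≤-reflexive (0≤p⇒∣p∣≡p 0≤q))

  bound-0 : ∀ {c} → 0ℚ ≤ c → Boundᶜ c 0ᶜ
  bound-0 0≤c = (λ _ → 0≤c) , (λ _ → 0≤c)

  bound-1 : Boundᶜ 1ℚ 1ᶜ
  bound-1 = (λ _ → ≤-refl) , (λ _ → <⇒≤ 0<1)

  bound-sum : ∀ {n c} (x : Vector ℂ n) → 0ℚ ≤ c → (∀ i → Boundᶜ c (x i)) → Boundᶜ (fromℕ n * c) (sumᶜ x)
  bound-sum {zero}  {c} x 0≤c h = bound-0 (0≤* {fromℕ 0} (0≤fromℕ 0) 0≤c)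
  bound-sum {suc n} {c} x 0≤c h = bound-mono {z = sumᶜ x} (≤-reflexive eq)
    (bound-+ (x zero) (sumᶜ (λ i → x (suc i))) (h zero) (bound-sum (λ i → x (suc i)) 0≤c (λ i → h (suc i))))
    where
    e : ∀ m c → c + m * c ≡ (1ℚ + m) * c
    e = solve 2 (λ m c → c :+ m :* c := (con 1ℚ :+ m) :* c) refl
    eq : c + fromℕ n * c ≡ fromℕ (suc n) * c
    eq = trans (e (fromℕ n) c) (cong (_* c) (sym (fromℕ-suc n)))

  0≤powℚ : ∀ {R} → 0ℚ ≤ R → ∀ k → 0ℚ ≤ powℚ R k
  0≤powℚ 0≤R zero    = <⇒≤ 0<1
  0≤powℚ {R} 0≤R (suc k) = 0≤* {R} 0≤R (0≤powℚ 0≤R k)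

  bound-power : ∀ {n c} (B : Matrix ℂ n) → 0ℚ ≤ c → (∀ i j → Boundᶜ c (B i j)) →
                ∀ k i j → Boundᶜ (powℚ (fromℕ n * (c + c)) k) (power B k i j)
  bound-power {n} {c} B 0≤c h zero i j with does (i Fin.≟ j)
  ... | true  = bound-1
  ... | false = bound-0 (<⇒≤ 0<1)
  bound-power {n} {c} B 0≤c h (suc k) i j = bound-mono {z = (B ⊗ power B k) i j} (≤-reflexive (e (fromℕ n) c P))
    (bound-sum (λ l → B i l *ᶜ power B k l j) (0≤+ {c * P} (0≤* {c} 0≤c 0≤P) (0≤* {c} 0≤c 0≤P))
      (λ l → bound-* (B i l) (power B k l j) 0≤P (h i l) (bound-power B 0≤c h k l j)))
    where
    P : ℚ
    P = powℚ (fromℕ n * (c + c)) k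
    0≤P : 0ℚ ≤ P
    0≤P = 0≤powℚ (0≤* {fromℕ n} (0≤fromℕ n) (0≤+ {c} 0≤c 0≤c)) k
    e : ∀ m c p → m * (c * p + c * p) ≡ m * (c + c) * p
    e = solve 3 (λ m c p → m :* (c :* p :+ c :* p) := m :* (c :+ c) :* p) refl

  common-bound : ∀ {n} (P : Fin n → ℚ → Set) → (∀ i {c d} → c ≤ d → P i c → P i d) →
                 (∀ i → ∃[ c ] P i c) → ∃[ c ] (0ℚ ≤ c × ∀ i → P i c)
  common-bound {zero}  P mono h = 0ℚ , ≤-refl , λ ()
  common-bound {suc n} P mono h =
    let c , p = h zero
        d , 0≤d , q = common-bound (λ i → P (suc i)) (λ i → mono (suc i)) (λ i → h (suc i))
    in c ⊔ d , ≤-trans 0≤d (p≤q⊔p c d) ,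
       λ { zero → mono zero (p≤p⊔q c d) p ; (suc i) → mono (suc i) (p≤q⊔p c d) (q i) }

  bound-exists : ∀ z → ∃[ c ] Boundᶜ c z
  bound-exists z =
    let c , _ , h  = bounded (seq (re z)) (cauchy (re z))
        d , _ , h′ = bounded (seq (im z)) (cauchy (im z))
    in c ⊔ d , (λ k → ≤-trans (h k) (p≤p⊔q c d)) , (λ k → ≤-trans (h′ k) (p≤q⊔p c d))

  bound-matrix : ∀ {n} (B : Matrix ℂ n) → ∃[ c ] (0ℚ ≤ c × ∀ i j → Boundᶜ c (B i j))
  bound-matrix B = common-bound (λ i c → ∀ j → Boundᶜ c (B i j))
    (λ i c≤d h j → bound-mono {z = B i j} c≤d (h j))
    (λ i → let c , _ , h = common-bound (λ j c → Boundᶜ c (B i j))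
                 (λ j c≤d h → bound-mono {z = B i j} c≤d h) (λ j → bound-exists (B i j))
           in c , h)

  -- A series dominated by a sequence that eventually halves is Cauchy.
  series-cauchy : (s : ℕ → ℝ) (a : ℕ → ℚ) (N₀ : ℕ) → (∀ k → 0ℚ ≤ a k) →
                  (∀ m k → ∣ seq (s (suc m)) k - seq (s m) k ∣ ≤ a m) →
                  (∀ k → N₀ ℕ.≤ k → a (suc k) ≤ ½ * a k) → IsCauchyᴿ s
  series-cauchy s a N₀ 0≤a s≤a a-half ε 0<ε =
    let K , h = Halving.→0 (λ k → a (k ℕ.+ N₀)) (λ k → 0≤a (k ℕ.+ N₀))
                  (λ k → a-half (k ℕ.+ N₀) (ℕ.m≤n+m N₀ k)) (0<½* 0<ε)
        small : ∀ n → K ℕ.+ N₀ ℕ.≤ n → a n ≤ ½ * ε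
        small n N≤n = subst (λ i → a i ≤ ½ * ε) (ℕ.m∸n+n≡m (ℕ.m+n≤o⇒n≤o K N≤n))
          (h (n ℕ.∸ N₀) (ℕ.m+n≤o⇒m≤o∸n K N≤n))
        close : ∀ m n → K ℕ.+ N₀ ℕ.≤ n → n ℕ.≤ m → ∀ k → ∣ seq (s m) k - seq (s n) k ∣ ≤ ε
        close m n N≤n n≤m k = subst (λ i → ∣ seq (s i) k - seq (s n) k ∣ ≤ ε) (ℕ.m∸n+n≡m n≤m)
          (≤-trans (tail n (ℕ.m+n≤o⇒n≤o K N≤n) k (m ℕ.∸ n))
            (finish (a n) (a (m ℕ.∸ n ℕ.+ n)) (0≤a (m ℕ.∸ n ℕ.+ n)) (small n N≤n)))
    in K ℕ.+ N₀ , λ m n N≤m N≤n δ 0<δ → 0 , λ k _ →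
      ≤-trans (either m n k (close m n N≤n) (close n m N≤m)) (p≤p+q ε (<⇒≤ 0<δ))
    where
    either : ∀ m n k → (n ℕ.≤ m → ∀ k → ∣ seq (s m) k - seq (s n) k ∣ ≤ ε) →
             (m ℕ.≤ n → ∀ k → ∣ seq (s n) k - seq (s m) k ∣ ≤ ε) → ∣ seq (s m) k - seq (s n) k ∣ ≤ ε
    either m n k f g with ℕ.≤-total n m
    ... | inj₁ n≤m = f n≤m k
    ... | inj₂ m≤n = ≤-trans (≤-reflexive (∣p-q∣≡∣q-p∣ (seq (s m) k) (seq (s n) k))) (g m≤n k)
    finish : ∀ x y → 0ℚ ≤ y → x ≤ ½ * ε → (x + x) - (y + y) ≤ ε
    finish x y 0≤y x≤ = ≤-trans (p≤q+r⇒p-q≤r {x + x} {y + y} (q≤p+q (x + x) (0≤+ {y} 0≤y 0≤y)))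
      (≤-trans (+-mono-≤ x≤ x≤) (≤-reflexive (half+half ε)))
    step : ∀ p q r x y z → ∣ p - q ∣ ≤ y → z ≤ ½ * y → ∣ q - r ∣ ≤ (x + x) - (y + y) →
           ∣ p - r ∣ ≤ (x + x) - (z + z)
    step p q r x y z pq z≤ qr = ≤-trans (triangle p q r) (≤-trans (+-mono-≤ pq qr)
      (≤-trans (≤-reflexive (e x y)) (+-monoʳ-≤ (x + x) (neg-antimono-≤
        (≤-trans (+-mono-≤ z≤ z≤) (≤-reflexive (half+half y)))))))
      where
      e : ∀ x y → y + ((x + x) - (y + y)) ≡ (x + x) - y
      e = solve 2 (λ x y → y :+ ((x :+ x) :- (y :+ y)) := (x :+ x) :- y) refl
    tail : ∀ n → N₀ ℕ.≤ n → ∀ k j → ∣ seq (s (j ℕ.+ n)) k - seq (s n) k ∣ ≤ (a n + a n) - (a (j ℕ.+ n) + a (j ℕ.+ n))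
    tail n N₀≤n k zero = ≤-trans (≤-reflexive (cong ∣_∣ (+-inverseʳ (seq (s n) k))))
      (≤-reflexive (sym (+-inverseʳ (a n + a n))))
    tail n N₀≤n k (suc j) = step (seq (s (suc (j ℕ.+ n))) k) (seq (s (j ℕ.+ n)) k) (seq (s n) k)
      (a n) (a (j ℕ.+ n)) (a (suc (j ℕ.+ n))) (s≤a (j ℕ.+ n) k)
      (a-half (j ℕ.+ n) (ℕ.≤-trans N₀≤n (ℕ.m≤n+m n j))) (tail n N₀≤n k j)

  exp-cauchy : ∀ {n} (B : Matrix ℂ n) i j →
    IsCauchyᴿ (λ N → re (expSum B N i j)) × IsCauchyᴿ (λ N → im (expSum B N i j))
  exp-cauchy {n} B i j =
    series-cauchy (λ N → re (expSum B N i j)) a N₀ 0≤a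
      (λ m k → diff≤ (seq (re (expSum B m i j)) k) _ (proj₁ (bound-term m) k)) a-half ,
    series-cauchy (λ N → im (expSum B N i j)) a N₀ 0≤a
      (λ m k → diff≤ (seq (im (expSum B m i j)) k) _ (proj₂ (bound-term m) k)) a-half
    where
    c R : ℚ
    c = proj₁ (bound-matrix B)
    0≤c : 0ℚ ≤ c
    0≤c = proj₁ (proj₂ (bound-matrix B))
    R = fromℕ n * (c + c)
    0≤R : 0ℚ ≤ R
    0≤R = 0≤* {fromℕ n} (0≤fromℕ n) (0≤+ {c} 0≤c 0≤c)
    N₀ : ℕ
    N₀ = proj₁ (≤fromℕ (R + R))
    a : ℕ → ℚ
    a k = powℚ R k * invFact k
    0≤a : ∀ k → 0ℚ ≤ a k
    0≤a k = 0≤* {powℚ R k} (0≤powℚ 0≤R k) (<⇒≤ (invFact-pos k))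
    bound-term : ∀ m → Boundᶜ (a m) (fromℝ (fromℚ (invFact m)) *ᶜ power B m i j)
    bound-term m = bound-real* (power B m i j) (<⇒≤ (invFact-pos m)) (0≤powℚ 0≤R m)
      (bound-power B 0≤c (proj₂ (proj₂ (bound-matrix B))) m i j)
    diff≤ : ∀ {d} p t → ∣ t ∣ ≤ d → ∣ (p + t) - p ∣ ≤ d
    diff≤ p t t≤ = ≤-trans (≤-reflexive (cong ∣_∣ (solve 2 (λ p t → (p :+ t) :- p := t) refl p t))) t≤
    a-half : ∀ k → N₀ ℕ.≤ k → a (suc k) ≤ ½ * a k
    a-half k N₀≤k = lemma R (powℚ R k) (invFact (suc k)) (fromℕ (suc k)) (invFact k)
      (0≤powℚ 0≤R k) (<⇒≤ (invFact-pos (suc k)))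
      (≤-trans (proj₂ (≤fromℕ (R + R))) (fromℕ-mono (ℕ.m≤n⇒m≤1+n N₀≤k))) (invFact-suc k)
      where
      lemma : ∀ R P f m g → 0ℚ ≤ P → 0ℚ ≤ f → R + R ≤ m → m * f ≡ g → R * P * f ≤ ½ * (P * g)
      lemma R P f m g 0≤P 0≤f 2R≤m refl = ≤-trans (≤-reflexive (e₁ R P f))
        (≤-trans (mulˡ-≤ {½ * (P * f)} (0≤* {½} 0≤½ (0≤* {P} 0≤P 0≤f)) 2R≤m) (≤-reflexive (e₂ P f m)))
        where
        e₁ : ∀ R P f → R * P * f ≡ ½ * (P * f) * (R + R)
        e₁ = solve 3 (λ R P f → R :* P :* f := con ½ :* (P :* f) :* (R :+ R)) refl
        e₂ : ∀ P f m → ½ * (P * f) * m ≡ ½ * (P * (m * f))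
        e₂ = solve 3 (λ P f m → con ½ :* (P :* f) :* m := con ½ :* (P :* (m :* f))) refl

-- The entrywise limit of the power series Σ Bᵏ / k!.
exp : ∀ {n} → Matrix ℂ n → Matrix ℂ n
exp B i j = lim (λ N → re (expSum B N i j)) (proj₁ (exp-cauchy B i j))
         +i lim (λ N → im (expSum B N i j)) (proj₂ (exp-cauchy B i j))

-- Only the values of weight on adjacent pairs are meaningful.
record WeightedGraph (n : ℕ) : Set₁ where
  field
    Adj        : Fin n → Fin n → Set
    Adj?       : Decidable Adj
    Adj-sym    : Symmetric Adj
    Adj-irrefl : ∀ {u} → ¬ Adj u u
    weight     : Fin n → Fin n → ℝ
    weight-sym : ∀ {u v} → Adj u v → weight u v ≈ weight v u
    weight-pos : ∀ {u v} → Adj u v → 0ᴿ <ᴿ weight u v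
    connected  : ∀ u v → Star Adj u v

module _ {n : ℕ} (X : WeightedGraph n) where
  open WeightedGraph X

  adjacencyMatrix : Matrix ℝ n
  adjacencyMatrix u v = if does (Adj? u v) then weight u v else 0ᴿ

  degree : Fin n → ℝ
  degree u = sumᴿ λ v → if does (Adj? u v) then weight u v else 0ᴿ

  degreeMatrix : Matrix ℝ n
  degreeMatrix u v = if does (u Fin.≟ v) then degree u else 0ᴿ

  laplacian : Matrix ℝ n
  laplacian u v = degreeMatrix u v -ᴿ adjacencyMatrix u v

  signlessLaplacian : Matrix ℝ n
  signlessLaplacian u v = degreeMatrix u v +ᴿ adjacencyMatrix u v

  neighborhood : Fin n → Pred (Fin n) 0ℓ
  neighborhood u = λ v → Adj u v

  Twins : Fin n → Fin n → Set
  Twins u v =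
    u ≢ v ×
    (neighborhood u ∖ ｛ v ｝) ≐ (neighborhood v ∖ ｛ u ｝) ×
    (∀ w → w ≢ u → w ≢ v → Adj u w → Adj v w → weight u w ≈ weight v w)

  HasTwin : Fin n → Set
  HasTwin u = ∃[ v ] Twins u v

U : ∀ {n} → Matrix ℝ n → ℝ → Matrix ℂ n
U M t = exp (λ u v → 𝕚 *ᶜ fromℝ (t *ᴿ M u v))

-- The constant vector (1/n) 𝟏; the vertex argument shows n ≠ 0.
uniform : ∀ {n} → Fin n → Vector ℂ n
uniform {n} u _ = fromℝ (fromℚ ((+ 1 / n) {{nonZeroIndex u}}))

LocalUniformMixing : ∀ {n} → Matrix ℝ n → Fin n → Set
LocalUniformMixing M u = ∀ ε → 0ᴿ <ᴿ ε →
  ∃[ τ ] ‖ (U M τ ⊗ᵛ 𝐞 u) ∘ᵛ (conjᵐ (U M τ) ⊗ᵛ 𝐞 u) -ᵛ uniform u ‖ <ᴿ ε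

{-# OPTIONS --safe #-}

-- If u and v are twins, then e_u − e_v is a left eigenvector of M with a real
-- eigenvalue θ, so U(t)_uu − U(t)_vu = e^{itθ} has modulus 1 at every time t.
-- Under mixing, ∣U(τ)_uu∣² and ∣U(τ)_vu∣² come arbitrarily close to 1/n, and
-- 1 = ∣a − b∣² ≤ 2 (∣a∣² + ∣b∣²) then gives 1 ≤ 4/n.
--
-- That ∣e^{iy}∣² ≥ 1 is read off the partial sums of cos and sin: by the Leibniz
-- rule all coefficients of cos² + sin² of positive degree vanish, and the error
-- of the truncated Cauchy product is at most a tail of the series of e^{2∣y∣}.
-- Operations on reals act termwise on the representing sequences, so all of this
-- is arithmetic of rationals.
module Submission where

open import Defs
open import Algebra.Bundles using (CommutativeRing)
import Algebra.Properties.Semiring.Sum as SemiringSum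
open import Data.Fin using (Fin; zero; suc; punchIn; punchOut)
import Data.Fin as Fin
open import Data.Fin.Properties using (punchIn-punchOut; punchInᵢ≢i; punchIn-injective; nonZeroIndex)
import Data.Integer as ℤ
import Data.Integer.Properties as ℤ
open import Data.List using ([]; _∷_)
open import Data.List.Membership.Propositional using (_∈_)
open import Data.List.Relation.Unary.Any using (here; there)
open import Data.Nat using (ℕ; zero; suc; _≤_)
import Data.Nat as ℕ
import Data.Nat.Properties as ℕ
open import Data.Product using (∃-syntax; _×_; _,_; proj₁; proj₂)
open import Data.Rational renaming (_≤_ to _≤ℚ_)
open import Data.Rational.Properties
open import Data.Rational.Solver using (module +-*-Solver)
open import Data.Rational.Unnormalised using (mkℚᵘ; *≤*)
import Data.Rational.Unnormalised.Properties as ℚᵘ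
open import Data.Sum using (inj₁; inj₂)
open import Data.Vec.Functional using (Vector)
open import Function using (_∘_)
open import Level using (0ℓ)
open import Relation.Binary using (IsEquivalence)
open import Relation.Binary.PropositionalEquality
open import Relation.Nullary using (¬_; yes; no; contradiction)
open import Relation.Nullary.Decidable using (dec-true; dec-false; from-no)

open +-*-Solver using (solve; _:+_; _:*_; _:-_; :-_; con; _:=_)

-- Cauchy products of rational power series

-- The eigenvalue is θ = M_uu - M_vu. The relation passes through every matrix product: the
-- difference of the (u,u) and (v,u) entries of (itM)^k is (itθ)^k, so the corresponding differences
-- of partial sums of U(t) are the partial sums of the scalar series of e^{iy} with y = tθ.
--
-- The obstacle is a pair of nested limits, one in the number of terms of the series and one in the
-- index k at which a real is approximated. The number m of terms is fixed first, while y is then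
-- visible only through the varying rationals `seq y k`. The estimate for cos² + sin² therefore has
-- to hold with one m for all rationals q with ∣q∣ ≤ r, where r bounds the whole sequence of y; this
-- is why everything is dominated by the series of e^r, not by one that depends on q. That its
-- Cauchy square is e^{2r} comes from the same device as cos² + sin² = 1: a coefficient of positive
-- degree is determined by the derivative.
--
-- Mixing gives 1/n only up to an error, so n ≥ 5 is refuted with one fixed error, small enough to
-- fit between 4/5 and 1.

partialSum : (ℕ → ℚ) → ℕ → ℚ
partialSum f zero    = 0ℚ
partialSum f (suc N) = partialSum f N + f N

-- The coefficient Σ f j * g (m - j) of a product of series. Peeling off the first coefficient of
-- `f` avoids subtraction of indices, and the inductions that unfold this recursion shift `f` only.
conv : (ℕ → ℚ) → (ℕ → ℚ) → ℕ → ℚ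
conv f g zero    = f 0 * g 0
conv f g (suc m) = f 0 * g (suc m) + conv (f ∘ suc) g m

-- The coefficients of the derivative of a power series.
δ : (ℕ → ℚ) → ℕ → ℚ
δ f k = fromℕ (suc k) * f (suc k)

fromℕ-1 : fromℕ 1 ≡ 1ℚ
fromℕ-1 = ≤-antisym (toℚᵘ-cancel-≤ (ℚᵘ.≤-reflexive (toℚᵘ-fromℕ 1))) (1≤fromℕ-suc 0)

conv-cong : ∀ {f f′ g g′} → (∀ k → f k ≡ f′ k) → (∀ k → g k ≡ g′ k) → ∀ m → conv f g m ≡ conv f′ g′ m
conv-cong f≡ g≡ zero    = cong₂ _*_ (f≡ 0) (g≡ 0)
conv-cong f≡ g≡ (suc m) = cong₂ _+_ (cong₂ _*_ (f≡ 0) (g≡ (suc m))) (conv-cong (f≡ ∘ suc) g≡ m)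

conv-+ˡ : ∀ f f′ g m → conv (λ k → f k + f′ k) g m ≡ conv f g m + conv f′ g m
conv-+ˡ f f′ g zero    = *-distribʳ-+ (g 0) (f 0) (f′ 0)
conv-+ˡ f f′ g (suc m) = trans
  (cong (λ w → (f 0 + f′ 0) * g (suc m) + w) (conv-+ˡ (f ∘ suc) (f′ ∘ suc) g m))
  (solve 5 (λ a b c x y → (a :+ b) :* c :+ (x :+ y) := a :* c :+ x :+ (b :* c :+ y)) refl
    (f 0) (f′ 0) (g (suc m)) (conv (f ∘ suc) g m) (conv (f′ ∘ suc) g m))

conv-*ˡ : ∀ c f g m → conv (λ k → c * f k) g m ≡ c * conv f g m
conv-*ˡ c f g zero    = *-assoc c (f 0) (g 0)
conv-*ˡ c f g (suc m) = trans (cong (λ w → c * f 0 * g (suc m) + w) (conv-*ˡ c (f ∘ suc) g m))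
  (solve 4 (λ c a b x → c :* a :* b :+ c :* x := c :* (a :* b :+ x)) refl
    c (f 0) (g (suc m)) (conv (f ∘ suc) g m))

conv-*ʳ : ∀ c f g m → conv f (λ k → c * g k) m ≡ c * conv f g m
conv-*ʳ c f g zero    = solve 3 (λ c a b → a :* (c :* b) := c :* (a :* b)) refl c (f 0) (g 0)
conv-*ʳ c f g (suc m) = trans (cong (λ w → f 0 * (c * g (suc m)) + w) (conv-*ʳ c (f ∘ suc) g m))
  (solve 4 (λ c a b x → a :* (c :* b) :+ c :* x := c :* (a :* b :+ x)) refl
    c (f 0) (g (suc m)) (conv (f ∘ suc) g m))

-- Shifting lowers each index by one while `δ` weights by the index, so the two commute only up to
-- one extra copy of the coefficient.
δ-shift : ∀ f k → δ f (suc k) ≡ δ (f ∘ suc) k + f (suc (suc k))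
δ-shift f k = trans (cong (_* f (suc (suc k))) (fromℕ-suc (suc k)))
  (solve 2 (λ n x → (con 1ℚ :+ n) :* x := n :* x :+ x) refl (fromℕ (suc k)) (f (suc (suc k))))

-- Induction on the degree with `f` shifted. The weight `1ℚ + n` on the tail
-- `conv (f ∘ suc) g (suc m)` is split: n copies go to the induction hypothesis, and the remaining
-- copy supplies the leading term of `conv (δ f) g` together with the correction `z` from `δ-shift`.
conv-leibniz : ∀ f g m → δ (conv f g) m ≡ conv (δ f) g m + conv f (δ g) m
conv-leibniz f g zero = lemma (fromℕ 1) (f 0) (f 1) (g 0) (g 1)
  where
  lemma : ∀ n a a′ b b′ → n * (a * b′ + a′ * b) ≡ n * a′ * b + a * (n * b′)
  lemma = solve 5 (λ n a a′ b b′ → n :* (a :* b′ :+ a′ :* b) := n :* a′ :* b :+ a :* (n :* b′)) refl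
conv-leibniz f g (suc m) = begin
  fromℕ (suc (suc m)) * (f 0 * g (suc (suc m)) + (f 1 * g (suc m) + z))
    ≡⟨ cong (_* (f 0 * g (suc (suc m)) + (f 1 * g (suc m) + z))) (fromℕ-suc (suc m)) ⟩
  (1ℚ + n) * (f 0 * g (suc (suc m)) + (f 1 * g (suc m) + z))
    ≡⟨ lemma₁ n (f 0) (g (suc (suc m))) (f 1 * g (suc m) + z) ⟩
  f 0 * ((1ℚ + n) * g (suc (suc m))) + (f 1 * g (suc m) + z) + n * (f 1 * g (suc m) + z)
    ≡⟨ cong (λ w → f 0 * ((1ℚ + n) * g (suc (suc m))) + (f 1 * g (suc m) + z) + w) (conv-leibniz (f ∘ suc) g m) ⟩
  f 0 * ((1ℚ + n) * g (suc (suc m))) + (f 1 * g (suc m) + z) + (x + y)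
    ≡⟨ lemma₂ (f 0) ((1ℚ + n) * g (suc (suc m))) (f 1) (g (suc m)) x y z ⟩
  1ℚ * f 1 * g (suc m) + (x + z) + (f 0 * ((1ℚ + n) * g (suc (suc m))) + y)
    ≡⟨ cong₂ _+_
         (cong₂ _+_ (cong (λ c → c * f 1 * g (suc m)) (sym fromℕ-1))
           (sym (trans (conv-cong (δ-shift f) (λ _ → refl) m)
                       (conv-+ˡ (δ (f ∘ suc)) (λ k → f (suc (suc k))) g m))))
         (cong (λ c → f 0 * (c * g (suc (suc m))) + y) (sym (fromℕ-suc (suc m)))) ⟩
  conv (δ f) g (suc m) + conv f (δ g) (suc m) ∎
  where
  open ≡-Reasoning
  n x y z : ℚ
  n = fromℕ (suc m)
  x = conv (δ (f ∘ suc)) g m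
  y = conv (f ∘ suc) (δ g) m
  z = conv (λ k → f (suc (suc k))) g m
  lemma₁ : ∀ n a b c → (1ℚ + n) * (a * b + c) ≡ a * ((1ℚ + n) * b) + c + n * c
  lemma₁ = solve 4 (λ n a b c → (con 1ℚ :+ n) :* (a :* b :+ c) := a :* ((con 1ℚ :+ n) :* b) :+ c :+ n :* c) refl
  lemma₂ : ∀ a b a′ b′ x y z → a * b + (a′ * b′ + z) + (x + y) ≡ 1ℚ * a′ * b′ + (x + z) + (a * b + y)
  lemma₂ = solve 7 (λ a b a′ b′ x y z →
    a :* b :+ (a′ :* b′ :+ z) :+ (x :+ y) := con 1ℚ :* a′ :* b′ :+ (x :+ z) :+ (a :* b :+ y)) refl

-- Recovers a coefficient of degree `suc m` from the derivative, so that a differential equation for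
-- a series becomes an induction on its coefficients.
fromℕ-suc-cancel : ∀ m {p q} → fromℕ (suc m) * p ≡ fromℕ (suc m) * q → p ≡ q
fromℕ-suc-cancel m {p} {q} e = ≤-antisym
  (mulˡ-cancel-≤ (fromℕ (suc m)) p q 0<n (≤-reflexive e))
  (mulˡ-cancel-≤ (fromℕ (suc m)) q p 0<n (≤-reflexive (sym e)))
  where
  0<n : 0ℚ < fromℕ (suc m)
  0<n = <-≤-trans 0<1 (1≤fromℕ-suc m)

partialSum-cong : ∀ {f g} → (∀ k → f k ≡ g k) → ∀ N → partialSum f N ≡ partialSum g N
partialSum-cong f≡g zero    = refl
partialSum-cong f≡g (suc N) = cong₂ _+_ (partialSum-cong f≡g N) (f≡g N)

partialSum-head : ∀ f N → partialSum f (suc N) ≡ f 0 + partialSum (f ∘ suc) N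
partialSum-head f zero    = +-comm 0ℚ (f 0)
partialSum-head f (suc N) = trans (cong (_+ f (suc N)) (partialSum-head f N))
  (+-assoc (f 0) (partialSum (f ∘ suc) N) (f (suc N)))

0≤partialSum : ∀ {f} → (∀ k → 0ℚ ≤ℚ f k) → ∀ N → 0ℚ ≤ℚ partialSum f N
0≤partialSum 0≤f zero    = ≤-refl
0≤partialSum {f} 0≤f (suc N) = 0≤+ {partialSum f N} (0≤partialSum 0≤f N) (0≤f N)

partialSum-mono : ∀ {f} → (∀ k → 0ℚ ≤ℚ f k) → ∀ p N → partialSum f N ≤ℚ partialSum f (p ℕ.+ N)
partialSum-mono 0≤f zero    N = ≤-refl
partialSum-mono {f} 0≤f (suc p) N =
  ≤-trans (partialSum-mono 0≤f p N) (p≤p+q (partialSum f (p ℕ.+ N)) (0≤f (p ℕ.+ N)))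

-- The triangle of pairs j + k ≤ N splits into its row j = 0 and the triangle, one size smaller,
-- that belongs to `f ∘ suc`.
partialSum-conv-suc : ∀ f g N →
  partialSum (conv f g) (suc N) ≡ f 0 * partialSum g (suc N) + partialSum (conv (f ∘ suc) g) N
partialSum-conv-suc f g zero =
  solve 2 (λ a b → con 0ℚ :+ a :* b := a :* (con 0ℚ :+ b) :+ con 0ℚ) refl (f 0) (g 0)
partialSum-conv-suc f g (suc N) = trans
  (cong (_+ (f 0 * g (suc N) + conv (f ∘ suc) g N)) (partialSum-conv-suc f g N))
  (solve 5 (λ a G b x y → a :* G :+ x :+ (a :* b :+ y) := a :* (G :+ b) :+ (x :+ y)) refl
    (f 0) (partialSum g (suc N)) (g (suc N)) (partialSum (conv (f ∘ suc) g) N) (conv (f ∘ suc) g N))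

0≤conv : ∀ {f g} → (∀ k → 0ℚ ≤ℚ f k) → (∀ k → 0ℚ ≤ℚ g k) → ∀ m → 0ℚ ≤ℚ conv f g m
0≤conv {f} {g} 0≤f 0≤g zero    = 0≤* {f 0} (0≤f 0) (0≤g 0)
0≤conv {f} {g} 0≤f 0≤g (suc m) =
  0≤+ {f 0 * g (suc m)} (0≤* {f 0} (0≤f 0) (0≤g (suc m))) (0≤conv (0≤f ∘ suc) 0≤g m)

-- Pairs with j < N and k < M satisfy j + k < N + M, and the additional terms of the triangle are
-- nonnegative.
rectangle≤triangle : ∀ {f g} → (∀ k → 0ℚ ≤ℚ f k) → (∀ k → 0ℚ ≤ℚ g k) → ∀ N M →
  partialSum f N * partialSum g M ≤ℚ partialSum (conv f g) (N ℕ.+ M)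
rectangle≤triangle {f} {g} 0≤f 0≤g zero M =
  ≤-trans (≤-reflexive (*-zeroˡ (partialSum g M))) (0≤partialSum (0≤conv 0≤f 0≤g) M)
rectangle≤triangle {f} {g} 0≤f 0≤g (suc N) M = begin
  partialSum f (suc N) * G                        ≡⟨ cong (_* G) (partialSum-head f N) ⟩
  (f 0 + partialSum (f ∘ suc) N) * G              ≡⟨ *-distribʳ-+ G (f 0) (partialSum (f ∘ suc) N) ⟩
  f 0 * G + partialSum (f ∘ suc) N * G            ≤⟨ +-mono-≤
    (mulˡ-≤ (0≤f 0) (partialSum-mono 0≤g (suc N) M)) (rectangle≤triangle (0≤f ∘ suc) 0≤g N M) ⟩
  f 0 * partialSum g (suc (N ℕ.+ M)) + partialSum (conv (f ∘ suc) g) (N ℕ.+ M)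
                                                  ≡⟨ sym (partialSum-conv-suc f g (N ℕ.+ M)) ⟩
  partialSum (conv f g) (suc (N ℕ.+ M))           ∎
  where
  open ≤-Reasoning
  G : ℚ
  G = partialSum g M

module Dominated {g G : ℕ → ℚ} (g≤G : ∀ k → ∣ g k ∣ ≤ℚ G k) where

  partialSum-diff : ∀ p N →
    ∣ partialSum g (p ℕ.+ N) - partialSum g N ∣ ≤ℚ partialSum G (p ℕ.+ N) - partialSum G N
  partialSum-diff zero N = ≤-reflexive (trans (cong ∣_∣ (+-inverseʳ (partialSum g N)))
    (sym (+-inverseʳ (partialSum G N))))
  partialSum-diff (suc p) N = begin
    ∣ (a + b) - c ∣        ≡⟨ cong ∣_∣ (move a b c) ⟩
    ∣ (a - c) + b ∣        ≤⟨ ∣p+q∣≤∣p∣+∣q∣ (a - c) b ⟩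
    ∣ a - c ∣ + ∣ b ∣      ≤⟨ +-mono-≤ (partialSum-diff p N) (g≤G (p ℕ.+ N)) ⟩
    (A - C) + B            ≡⟨ sym (move A B C) ⟩
    (A + B) - C            ∎
    where
    open ≤-Reasoning
    a b c A B C : ℚ
    a = partialSum g (p ℕ.+ N)
    b = g (p ℕ.+ N)
    c = partialSum g N
    A = partialSum G (p ℕ.+ N)
    B = G (p ℕ.+ N)
    C = partialSum G N
    move : ∀ a b c → (a + b) - c ≡ (a - c) + b
    move = solve 3 (λ a b c → (a :+ b) :- c := (a :- c) :+ b) refl

  -- Both sides run over the pairs (j , k) with j < N, k < p + N and j + k ≥ N.
  rectangle-triangle : ∀ f F → (∀ k → ∣ f k ∣ ≤ℚ F k) → ∀ N p →
    ∣ partialSum f N * partialSum g (p ℕ.+ N) - partialSum (conv f g) N ∣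
    ≤ℚ partialSum F N * partialSum G (p ℕ.+ N) - partialSum (conv F G) N
  rectangle-triangle f F f≤F zero p = ≤-reflexive (trans (cong ∣_∣ (e (partialSum g (p ℕ.+ 0))))
    (sym (e (partialSum G (p ℕ.+ 0)))))
    where
    e : ∀ x → 0ℚ * x - 0ℚ ≡ 0ℚ
    e = solve 1 (λ x → con 0ℚ :* x :- con 0ℚ := con 0ℚ) refl
  rectangle-triangle f F f≤F (suc N) p rewrite ℕ.+-suc p N = begin
    ∣ partialSum f (suc N) * g₂ - partialSum (conv f g) (suc N) ∣
      ≡⟨ cong ∣_∣ (split f g) ⟩
    ∣ f 0 * (g₂ - partialSum g (suc N)) + r ∣
      ≤⟨ ∣p+q∣≤∣p∣+∣q∣ (f 0 * (g₂ - partialSum g (suc N))) r ⟩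
    ∣ f 0 * (g₂ - partialSum g (suc N)) ∣ + ∣ r ∣
      ≤⟨ +-mono-≤
           (∣p*q∣≤ (f 0) (g₂ - partialSum g (suc N))
             (≤-trans (0≤∣p∣ (g₂ - partialSum g (suc N))) diff) (f≤F 0) diff)
           -- Shifting `f` lowers `N` by one while the length of the sum over `g` must not change,
           -- so `p` grows by one; this is what the parameter `p` is for.
           (rectangle-triangle (f ∘ suc) (F ∘ suc) (f≤F ∘ suc) N (suc p)) ⟩
    F 0 * (partialSum G (suc (p ℕ.+ N)) - partialSum G (suc N))
      + (partialSum (F ∘ suc) N * partialSum G (suc (p ℕ.+ N)) - partialSum (conv (F ∘ suc) G) N)
      ≡⟨ sym (split F G) ⟩
    partialSum F (suc N) * partialSum G (suc (p ℕ.+ N)) - partialSum (conv F G) (suc N) ∎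
    where
    open ≤-Reasoning
    g₂ r : ℚ
    g₂ = partialSum g (suc (p ℕ.+ N))
    r = partialSum (f ∘ suc) N * g₂ - partialSum (conv (f ∘ suc) g) N
    diff : ∣ g₂ - partialSum g (suc N) ∣ ≤ℚ partialSum G (suc (p ℕ.+ N)) - partialSum G (suc N)
    diff = subst (λ i → ∣ partialSum g i - partialSum g (suc N) ∣ ≤ℚ partialSum G i - partialSum G (suc N))
      (ℕ.+-suc p N) (partialSum-diff p (suc N))
    split : ∀ f g → partialSum f (suc N) * partialSum g (suc (p ℕ.+ N)) - partialSum (conv f g) (suc N)
      ≡ f 0 * (partialSum g (suc (p ℕ.+ N)) - partialSum g (suc N))
        + (partialSum (f ∘ suc) N * partialSum g (suc (p ℕ.+ N)) - partialSum (conv (f ∘ suc) g) N)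
    split f g = trans
      (cong₂ (λ x y → x * partialSum g (suc (p ℕ.+ N)) - y) (partialSum-head f N) (partialSum-conv-suc f g N))
      (solve 5 (λ a x G c y → (a :+ x) :* G :- (a :* c :+ y) := a :* (G :- c) :+ (x :* G :- y)) refl
        (f 0) (partialSum (f ∘ suc) N) (partialSum g (suc (p ℕ.+ N))) (partialSum g (suc N))
        (partialSum (conv (f ∘ suc) g) N))

-- The error is dominated by the square minus the triangle for the majorants. Enlarging that square
-- to the triangle of size `N ℕ.+ N` turns the bound into a piece of the tail of one series.
cauchy-product-error : ∀ {f g F G} → (∀ k → ∣ f k ∣ ≤ℚ F k) → (∀ k → ∣ g k ∣ ≤ℚ G k) → ∀ N →
  ∣ partialSum f N * partialSum g N - partialSum (conv f g) N ∣
  ≤ℚ partialSum (conv F G) (N ℕ.+ N) - partialSum (conv F G) N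
cauchy-product-error {f} {g} {F} {G} f≤F g≤G N = ≤-trans
  (Dominated.rectangle-triangle g≤G f F f≤F N 0)
  (+-monoˡ-≤ (- partialSum (conv F G) N)
    (rectangle≤triangle (λ k → ≤-trans (0≤∣p∣ (f k)) (f≤F k)) (λ k → ≤-trans (0≤∣p∣ (g k)) (g≤G k)) N N))

-- The exponential, cosine and sine series

expTerm : ℚ → ℕ → ℚ
expTerm r k = powℚ r k * invFact k

δ-expTerm : ∀ r k → δ (expTerm r) k ≡ r * expTerm r k
δ-expTerm r k = trans
  (solve 4 (λ n r p f → n :* (r :* p :* f) := r :* (p :* (n :* f))) refl
    (fromℕ (suc k)) r (powℚ r k) (invFact (suc k)))
  (cong (λ x → r * (powℚ r k * x)) (invFact-suc k))

-- Both sides have constant term 1 and solve the equation f′ = 2 r f, which determines each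
-- coefficient from the preceding one.
conv-expTerm : ∀ r m → conv (expTerm r) (expTerm r) m ≡ expTerm (r + r) m
conv-expTerm r zero    = refl
conv-expTerm r (suc m) = fromℕ-suc-cancel m (begin
  δ (conv b b) m                      ≡⟨ conv-leibniz b b m ⟩
  conv (δ b) b m + conv b (δ b) m     ≡⟨ cong₂ _+_
    (trans (conv-cong (δ-expTerm r) (λ _ → refl) m) (conv-*ˡ r b b m))
    (trans (conv-cong {f = b} (λ _ → refl) (δ-expTerm r) m) (conv-*ʳ r b b m)) ⟩
  r * conv b b m + r * conv b b m     ≡⟨ sym (*-distribʳ-+ (conv b b m) r r) ⟩
  (r + r) * conv b b m                ≡⟨ cong ((r + r) *_) (conv-expTerm r m) ⟩
  (r + r) * expTerm (r + r) m         ≡⟨ sym (δ-expTerm (r + r) m) ⟩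
  δ (expTerm (r + r)) m               ∎)
  where
  open ≡-Reasoning
  b : ℕ → ℚ
  b = expTerm r

0≤expTerm : ∀ {r} → 0ℚ ≤ℚ r → ∀ k → 0ℚ ≤ℚ expTerm r k
0≤expTerm {r} 0≤r k = 0≤* {powℚ r k} (0≤powℚ 0≤r k) (<⇒≤ (invFact-pos k))

-- The ratio of consecutive terms is r / (k + 1), which is at most one half once k + 1 ≥ 2 r.
expTerm-half : ∀ {r} → 0ℚ ≤ℚ r → ∃[ N ] (∀ k → N ≤ k → expTerm r (suc k) ≤ℚ ½ * expTerm r k)
expTerm-half {r} 0≤r = proj₁ (≤fromℕ (r + r)) , λ k N≤k →
  mulˡ-cancel-≤ (fromℕ (suc k)) (expTerm r (suc k)) (½ * expTerm r k) (<-≤-trans 0<1 (1≤fromℕ-suc k)) (begin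
    δ (expTerm r) k                   ≡⟨ δ-expTerm r k ⟩
    r * expTerm r k                   ≡⟨ e₁ r (expTerm r k) ⟩
    (r + r) * (½ * expTerm r k)       ≤⟨ mulʳ-≤ (0≤* {½} 0≤½ (0≤expTerm 0≤r k))
      (≤-trans (proj₂ (≤fromℕ (r + r))) (fromℕ-mono (ℕ.m≤n⇒m≤1+n N≤k))) ⟩
    fromℕ (suc k) * (½ * expTerm r k) ∎)
  where
  open ≤-Reasoning
  e₁ : ∀ r x → r * x ≡ (r + r) * (½ * x)
  e₁ = solve 2 (λ r x → r :* x := (r :+ r) :* (con ½ :* x)) refl

expSeries-cauchy : ∀ {r} → 0ℚ ≤ℚ r → ∀ {ε} → 0ℚ < ε →
  ∃[ N ] (∀ m n → N ≤ m → N ≤ n → ∣ partialSum (expTerm r) m - partialSum (expTerm r) n ∣ ≤ℚ ε)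
expSeries-cauchy {r} 0≤r {ε} 0<ε =
  let N₀ , half = expTerm-half 0≤r
      N , h = series-cauchy (λ N → fromℚ (partialSum (expTerm r) N)) (expTerm r) N₀ (0≤expTerm 0≤r)
                (λ m _ → ≤-reflexive (trans (cong ∣_∣ (e (partialSum (expTerm r) m) (expTerm r m)))
                  (0≤p⇒∣p∣≡p (0≤expTerm 0≤r m))))
                half (½ * ε) (0<½* 0<ε)
  in N , λ m n N≤m N≤n → let K , b = h m n N≤m N≤n (½ * ε) (0<½* 0<ε) in
     ≤-trans (b K ℕ.≤-refl) (≤-reflexive (half+half ε))
  where
  e : ∀ p t → (p + t) - p ≡ t
  e = solve 2 (λ p t → (p :+ t) :- p := t) refl

-- The real and imaginary parts of (i q)ᵏ.
rePow imPow : ℚ → ℕ → ℚ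
rePow q zero    = 1ℚ
rePow q (suc k) = 0ℚ * rePow q k - q * imPow q k
imPow q zero    = 0ℚ
imPow q (suc k) = 0ℚ * imPow q k + q * rePow q k

-- As power series in x these are cos (q x) and sin (q x), with zeros in the degrees of the wrong
-- parity; hence `δ` brings out a factor q.
cosTerm sinTerm : ℚ → ℕ → ℚ
cosTerm q k = rePow q k * invFact k
sinTerm q k = imPow q k * invFact k

δ-cosTerm : ∀ q k → δ (cosTerm q) k ≡ (- q) * sinTerm q k
δ-cosTerm q k = trans
  (solve 5 (λ n q a b f → n :* ((con 0ℚ :* a :- q :* b) :* f) := (:- q) :* (b :* (n :* f))) refl
    (fromℕ (suc k)) q (rePow q k) (imPow q k) (invFact (suc k)))
  (cong (λ x → (- q) * (imPow q k * x)) (invFact-suc k))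

δ-sinTerm : ∀ q k → δ (sinTerm q) k ≡ q * cosTerm q k
δ-sinTerm q k = trans
  (solve 5 (λ n q a b f → n :* ((con 0ℚ :* b :+ q :* a) :* f) := q :* (a :* (n :* f))) refl
    (fromℕ (suc k)) q (rePow q k) (imPow q k) (invFact (suc k)))
  (cong (λ x → q * (rePow q k * x)) (invFact-suc k))

-- The coefficients of cos² + sin² = 1, whose derivative vanishes.
conv-cos²+sin² : ∀ q m → conv (cosTerm q) (cosTerm q) (suc m) + conv (sinTerm q) (sinTerm q) (suc m) ≡ 0ℚ
conv-cos²+sin² q m = fromℕ-suc-cancel m (begin
  fromℕ (suc m) * (conv c c (suc m) + conv s s (suc m))
    ≡⟨ *-distribˡ-+ (fromℕ (suc m)) (conv c c (suc m)) (conv s s (suc m)) ⟩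
  δ (conv c c) m + δ (conv s s) m
    ≡⟨ cong₂ _+_ (conv-leibniz c c m) (conv-leibniz s s m) ⟩
  (conv (δ c) c m + conv c (δ c) m) + (conv (δ s) s m + conv s (δ s) m)
    ≡⟨ cong₂ _+_
         (cong₂ _+_ (trans (conv-cong (δ-cosTerm q) (λ _ → refl) m) (conv-*ˡ (- q) s c m))
                    (trans (conv-cong {f = c} (λ _ → refl) (δ-cosTerm q) m) (conv-*ʳ (- q) c s m)))
         (cong₂ _+_ (trans (conv-cong (δ-sinTerm q) (λ _ → refl) m) (conv-*ˡ q c s m))
                    (trans (conv-cong {f = s} (λ _ → refl) (δ-sinTerm q) m) (conv-*ʳ q s c m))) ⟩
  ((- q) * conv s c m + (- q) * conv c s m) + (q * conv c s m + q * conv s c m)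
    ≡⟨ cancel q (conv s c m) (conv c s m) (fromℕ (suc m)) ⟩
  fromℕ (suc m) * 0ℚ ∎)
  where
  open ≡-Reasoning
  c s : ℕ → ℚ
  c = cosTerm q
  s = sinTerm q
  cancel : ∀ q x y n → ((- q) * x + (- q) * y) + (q * y + q * x) ≡ n * 0ℚ
  cancel = solve 4 (λ q x y n → ((:- q) :* x :+ (:- q) :* y) :+ (q :* y :+ q :* x) := n :* con 0ℚ) refl

partialSum-cos²+sin² : ∀ q N →
  partialSum (conv (cosTerm q) (cosTerm q)) (suc N) + partialSum (conv (sinTerm q) (sinTerm q)) (suc N) ≡ 1ℚ
partialSum-cos²+sin² q zero    = refl
partialSum-cos²+sin² q (suc N) = trans
  (solve 4 (λ a b x y → (a :+ x) :+ (b :+ y) := (a :+ b) :+ (x :+ y)) refl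
    (partialSum (conv c c) (suc N)) (partialSum (conv s s) (suc N)) (conv c c (suc N)) (conv s s (suc N)))
  (cong₂ _+_ (partialSum-cos²+sin² q N) (conv-cos²+sin² q N))
  where
  c s : ℕ → ℚ
  c = cosTerm q
  s = sinTerm q

module _ {q r : ℚ} (q≤r : ∣ q ∣ ≤ℚ r) where

  private
    0≤r : 0ℚ ≤ℚ r
    0≤r = ≤-trans (0≤∣p∣ q) q≤r

  ∣rePow∣≤ : ∀ k → ∣ rePow q k ∣ ≤ℚ powℚ r k
  ∣imPow∣≤ : ∀ k → ∣ imPow q k ∣ ≤ℚ powℚ r k
  ∣rePow∣≤ zero    = ≤-refl
  ∣rePow∣≤ (suc k) = ≤-trans
    (≤-reflexive (trans (cong ∣_∣ (solve 3 (λ q a b → con 0ℚ :* a :- q :* b := :- (q :* b)) refl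
      q (rePow q k) (imPow q k))) (∣-p∣≡∣p∣ (q * imPow q k))))
    (∣p*q∣≤ q (imPow q k) (0≤powℚ 0≤r k) q≤r (∣imPow∣≤ k))
  ∣imPow∣≤ zero    = <⇒≤ 0<1
  ∣imPow∣≤ (suc k) = ≤-trans
    (≤-reflexive (cong ∣_∣ (solve 3 (λ q a b → con 0ℚ :* b :+ q :* a := q :* a) refl
      q (rePow q k) (imPow q k))))
    (∣p*q∣≤ q (rePow q k) (0≤powℚ 0≤r k) q≤r (∣rePow∣≤ k))

  ∣cosTerm∣≤ : ∀ k → ∣ cosTerm q k ∣ ≤ℚ expTerm r k
  ∣cosTerm∣≤ k = ∣p*q∣≤ (rePow q k) (invFact k) (<⇒≤ (invFact-pos k)) (∣rePow∣≤ k)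
    (≤-reflexive (0≤p⇒∣p∣≡p (<⇒≤ (invFact-pos k))))

  ∣sinTerm∣≤ : ∀ k → ∣ sinTerm q k ∣ ≤ℚ expTerm r k
  ∣sinTerm∣≤ k = ∣p*q∣≤ (imPow q k) (invFact k) (<⇒≤ (invFact-pos k)) (∣imPow∣≤ k)
    (≤-reflexive (0≤p⇒∣p∣≡p (<⇒≤ (invFact-pos k))))

cosSum sinSum : ℚ → ℕ → ℚ
cosSum q = partialSum (cosTerm q)
sinSum q = partialSum (sinTerm q)

-- The threshold depends on `r` and not on `q`, because `q` will be an approximation of y that
-- changes with the index after the number of terms has been fixed.
1≤cos²+sin² : ∀ {r} → 0ℚ ≤ℚ r → ∀ {ε} → 0ℚ < ε → ∃[ N ] (∀ m → N ≤ m → ∀ q → ∣ q ∣ ≤ℚ r →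
  1ℚ ≤ℚ cosSum q m * cosSum q m + sinSum q m * sinSum q m + ε)
-- The successor forces m to be positive, so that the sum includes the constant term, the only
-- degree in which cos² + sin² has a nonzero coefficient.
1≤cos²+sin² {r} 0≤r {ε} 0<ε = suc N , bound
  where
  0≤r+r : 0ℚ ≤ℚ r + r
  0≤r+r = 0≤+ {r} 0≤r 0≤r
  N : ℕ
  N = proj₁ (expSeries-cauchy 0≤r+r (0<½* 0<ε))
  b : ℕ → ℚ
  b = expTerm r
  tail≤ : ∀ m → N ≤ m → partialSum (conv b b) (m ℕ.+ m) - partialSum (conv b b) m ≤ℚ ½ * ε
  tail≤ m N≤m = ≤-trans
    (≤-reflexive (cong₂ _-_ (partialSum-cong (conv-expTerm r) (m ℕ.+ m)) (partialSum-cong (conv-expTerm r) m)))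
    (≤-trans (p≤∣p∣ _)
      (proj₂ (expSeries-cauchy 0≤r+r (0<½* 0<ε)) (m ℕ.+ m) m (ℕ.≤-trans N≤m (ℕ.m≤m+n m m)) N≤m))
  lower : ∀ x y → ∣ x - y ∣ ≤ℚ ½ * ε → y ≤ℚ x + ½ * ε
  lower x y h = p-q≤r⇒p≤q+r {y} {x}
    (≤-trans (p≤∣p∣ (y - x)) (≤-trans (≤-reflexive (∣p-q∣≡∣q-p∣ y x)) h))
  bound : ∀ m → suc N ≤ m → ∀ q → ∣ q ∣ ≤ℚ r → 1ℚ ≤ℚ cosSum q m * cosSum q m + sinSum q m * sinSum q m + ε
  bound m@(suc m′) N<m q q≤r = begin
    1ℚ                                                          ≡⟨ sym (partialSum-cos²+sin² q m′) ⟩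
    partialSum (conv c c) m + partialSum (conv s s) m           ≤⟨ +-mono-≤
      (lower (C * C) (partialSum (conv c c) m) (≤-trans (cauchy-product-error (∣cosTerm∣≤ q≤r) (∣cosTerm∣≤ q≤r) m) (tail≤ m (ℕ.<⇒≤ N<m))))
      (lower (S * S) (partialSum (conv s s) m) (≤-trans (cauchy-product-error (∣sinTerm∣≤ q≤r) (∣sinTerm∣≤ q≤r) m) (tail≤ m (ℕ.<⇒≤ N<m)))) ⟩
    (C * C + ½ * ε) + (S * S + ½ * ε)                           ≡⟨ regroup (C * C) (S * S) ε ⟩
    C * C + S * S + ε                                           ∎
    where
    open ≤-Reasoning
    c s : ℕ → ℚ
    c = cosTerm q
    s = sinTerm q
    C S : ℚ
    C = cosSum q m
    S = sinSum q m
    regroup : ∀ a b e → (a + ½ * e) + (b + ½ * e) ≡ a + b + e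
    regroup = solve 3 (λ a b e → (a :+ con ½ :* e) :+ (b :+ con ½ :* e) := a :+ b :+ e) refl

-- The rings of real and complex numbers

Eventually : (ℕ → Set) → Set
Eventually P = ∃[ N ] (∀ k → N ≤ k → P k)

map-eventually : ∀ {P Q : ℕ → Set} → (∀ k → P k → Q k) → Eventually P → Eventually Q
map-eventually f (N , p) = N , λ k N≤k → f k (p k N≤k)

zip-eventually : ∀ {P Q R : ℕ → Set} → (∀ k → P k → Q k → R k) → Eventually P → Eventually Q → Eventually R
zip-eventually f (M , p) (N , q) = M ℕ.⊔ N , λ k h →
  f k (p k (ℕ.m⊔n≤o⇒m≤o M N h)) (q k (ℕ.m⊔n≤o⇒n≤o M N h))

pointwise : ∀ {x y} → (∀ k → seq x k ≡ seq y k) → x ≈ y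
pointwise {x} {y} h ε 0<ε = 0 , λ k _ →
  ≤-trans (≤-reflexive (trans (cong (λ q → ∣ q - seq y k ∣) (h k)) (cong ∣_∣ (+-inverseʳ (seq y k))))) (<⇒≤ 0<ε)

≈-sym : ∀ {x y} → x ≈ y → y ≈ x
≈-sym {x} {y} h ε 0<ε = map-eventually (λ k → ≤-trans (≤-reflexive (∣p-q∣≡∣q-p∣ (seq y k) (seq x k)))) (h ε 0<ε)

≈-trans : ∀ {x y z} → x ≈ y → y ≈ z → x ≈ z
≈-trans {x} {y} {z} h₁ h₂ ε 0<ε = zip-eventually
  (λ k a b → ≤-trans (triangle (seq x k) (seq y k) (seq z k)) (≤-trans (+-mono-≤ a b) (≤-reflexive (half+half ε))))
  (h₁ (½ * ε) (0<½* 0<ε)) (h₂ (½ * ε) (0<½* 0<ε))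

+ᴿ-cong : ∀ {x x′ y y′} → x ≈ x′ → y ≈ y′ → x +ᴿ y ≈ x′ +ᴿ y′
+ᴿ-cong {x} {x′} {y} {y′} h₁ h₂ ε 0<ε = zip-eventually
  (λ k a b → ≤-trans (≤-reflexive (cong ∣_∣ (e (seq x k) (seq y k) (seq x′ k) (seq y′ k))))
    (≤-trans (∣p+q∣≤∣p∣+∣q∣ (seq x k - seq x′ k) (seq y k - seq y′ k))
      (≤-trans (+-mono-≤ a b) (≤-reflexive (half+half ε)))))
  (h₁ (½ * ε) (0<½* 0<ε)) (h₂ (½ * ε) (0<½* 0<ε))
  where
  e : ∀ a b c d → (a + b) - (c + d) ≡ (a - c) + (b - d)
  e = solve 4 (λ a b c d → (a :+ b) :- (c :+ d) := (a :- c) :+ (b :- d)) refl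

-ᴿ-cong : ∀ {x y} → x ≈ y → -ᴿ x ≈ -ᴿ y
-ᴿ-cong {x} {y} h ε 0<ε = map-eventually (λ k → ≤-trans (≤-reflexive (e (seq x k) (seq y k)))) (h ε 0<ε)
  where
  e : ∀ a b → ∣ - a - - b ∣ ≡ ∣ a - b ∣
  e a b = trans (cong ∣_∣ (solve 2 (λ a b → :- a :- :- b := b :- a) refl a b)) (∣p-q∣≡∣q-p∣ b a)

*ᴿ-congˡ : ∀ x {y y′} → y ≈ y′ → x *ᴿ y ≈ x *ᴿ y′
*ᴿ-congˡ x {y} {y′} h ε 0<ε =
  let c , 0<c , x≤c = bounded (seq x) (cauchy x)
      d , 0<d , cd≡ε = divide 0<ε 0<c
  in map-eventually (λ k a → ≤-trans (≤-reflexive (cong ∣_∣ (e (seq x k) (seq y k) (seq y′ k))))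
       (≤-trans (∣p*q∣≤ (seq x k) (seq y k - seq y′ k) (<⇒≤ 0<d) (x≤c k) a) (≤-reflexive cd≡ε)))
     (h d 0<d)
  where
  e : ∀ a b c → a * b - a * c ≡ a * (b - c)
  e = solve 3 (λ a b c → a :* b :- a :* c := a :* (b :- c)) refl

*ᴿ-comm : ∀ x y → x *ᴿ y ≈ y *ᴿ x
*ᴿ-comm x y = pointwise {x *ᴿ y} {y *ᴿ x} λ k → *-comm (seq x k) (seq y k)

*ᴿ-cong : ∀ {x x′ y y′} → x ≈ x′ → y ≈ y′ → x *ᴿ y ≈ x′ *ᴿ y′
*ᴿ-cong {x} {x′} {y} {y′} h₁ h₂ = ≈-trans {x *ᴿ y} {x *ᴿ y′} {x′ *ᴿ y′} (*ᴿ-congˡ x {y} {y′} h₂)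
  (≈-trans {x *ᴿ y′} {y′ *ᴿ x} {x′ *ᴿ y′} (*ᴿ-comm x y′)
    (≈-trans {y′ *ᴿ x} {y′ *ᴿ x′} {x′ *ᴿ y′} (*ᴿ-congˡ y′ {x} {x′} h₁) (*ᴿ-comm y′ x′)))

≈-isEquivalence : IsEquivalence _≈_
≈-isEquivalence = record
  { refl  = λ {x} → pointwise {x} {x} λ _ → refl
  ; sym   = λ {x} {y} → ≈-sym {x} {y}
  ; trans = λ {x} {y} {z} → ≈-trans {x} {y} {z}
  }

ℝ-commutativeRing : CommutativeRing 0ℓ 0ℓ
ℝ-commutativeRing = record
  { Carrier = ℝ ; _≈_ = _≈_ ; _+_ = _+ᴿ_ ; _*_ = _*ᴿ_ ; -_ = -ᴿ_ ; 0# = 0ᴿ ; 1# = 1ᴿ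
  ; isCommutativeRing = record
    { isRing = record
      { +-isAbelianGroup = record
        { isGroup = record
          { isMonoid = record
            { isSemigroup = record
              { isMagma = record
                { isEquivalence = ≈-isEquivalence
                ; ∙-cong = λ {x} {x′} {y} {y′} → +ᴿ-cong {x} {x′} {y} {y′}
                }
              ; assoc = λ x y z → pointwise {(x +ᴿ y) +ᴿ z} {x +ᴿ (y +ᴿ z)}
                  λ k → +-assoc (seq x k) (seq y k) (seq z k)
              }
            ; identity = (λ x → pointwise {0ᴿ +ᴿ x} {x} λ k → +-identityˡ (seq x k))
                       , (λ x → pointwise {x +ᴿ 0ᴿ} {x} λ k → +-identityʳ (seq x k))
            }
          ; inverse = (λ x → pointwise {(-ᴿ x) +ᴿ x} {0ᴿ} λ k → +-inverseˡ (seq x k))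
                    , (λ x → pointwise {x +ᴿ (-ᴿ x)} {0ᴿ} λ k → +-inverseʳ (seq x k))
          ; ⁻¹-cong = λ {x} {y} → -ᴿ-cong {x} {y}
          }
        ; comm = λ x y → pointwise {x +ᴿ y} {y +ᴿ x} λ k → +-comm (seq x k) (seq y k)
        }
      ; *-cong = λ {x} {x′} {y} {y′} → *ᴿ-cong {x} {x′} {y} {y′}
      ; *-assoc = λ x y z → pointwise {(x *ᴿ y) *ᴿ z} {x *ᴿ (y *ᴿ z)}
          λ k → *-assoc (seq x k) (seq y k) (seq z k)
      ; *-identity = (λ x → pointwise {1ᴿ *ᴿ x} {x} λ k → *-identityˡ (seq x k))
                   , (λ x → pointwise {x *ᴿ 1ᴿ} {x} λ k → *-identityʳ (seq x k))
      ; distrib = (λ x y z → pointwise {x *ᴿ (y +ᴿ z)} {x *ᴿ y +ᴿ x *ᴿ z}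
                    λ k → *-distribˡ-+ (seq x k) (seq y k) (seq z k))
                , (λ x y z → pointwise {(y +ᴿ z) *ᴿ x} {y *ᴿ x +ᴿ z *ᴿ x}
                    λ k → *-distribʳ-+ (seq x k) (seq y k) (seq z k))
      }
    ; *-comm = *ᴿ-comm
    }
  }

infix 4 _≈ᶜ_

_≈ᶜ_ : ℂ → ℂ → Set
z ≈ᶜ w = re z ≈ re w × im z ≈ im w

pointwiseᶜ : ∀ {z w} → (∀ k → seq (re z) k ≡ seq (re w) k) → (∀ k → seq (im z) k ≡ seq (im w) k) → z ≈ᶜ w
pointwiseᶜ {z} {w} h₁ h₂ = pointwise {re z} {re w} h₁ , pointwise {im z} {im w} h₂

-ᶜ_ : ℂ → ℂ
-ᶜ z = (-ᴿ re z) +i (-ᴿ im z)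

module ℝ-Ring = CommutativeRing ℝ-commutativeRing

*ᶜ-cong : ∀ {z z′ w w′} → z ≈ᶜ z′ → w ≈ᶜ w′ → z *ᶜ w ≈ᶜ z′ *ᶜ w′
*ᶜ-cong {z} {z′} {w} {w′} (a , b) (c , d) =
  +ᴿ-cong {re z *ᴿ re w} {re z′ *ᴿ re w′} { -ᴿ (im z *ᴿ im w)} { -ᴿ (im z′ *ᴿ im w′)}
    (*ᴿ-cong {re z} {re z′} {re w} {re w′} a c)
    (-ᴿ-cong {im z *ᴿ im w} {im z′ *ᴿ im w′} (*ᴿ-cong {im z} {im z′} {im w} {im w′} b d)) ,
  +ᴿ-cong {re z *ᴿ im w} {re z′ *ᴿ im w′} {im z *ᴿ re w} {im z′ *ᴿ re w′}
    (*ᴿ-cong {re z} {re z′} {im w} {im w′} a d) (*ᴿ-cong {im z} {im z′} {re w} {re w′} b c)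

ℂ-commutativeRing : CommutativeRing 0ℓ 0ℓ
ℂ-commutativeRing = record
  { Carrier = ℂ ; _≈_ = _≈ᶜ_ ; _+_ = _+ᶜ_ ; _*_ = _*ᶜ_ ; -_ = -ᶜ_ ; 0# = 0ᶜ ; 1# = 1ᶜ
  ; isCommutativeRing = record
    { isRing = record
      { +-isAbelianGroup = record
        { isGroup = record
          { isMonoid = record
            { isSemigroup = record
              { isMagma = record
                { isEquivalence = record
                  { refl  = λ {z} → pointwiseᶜ {z} {z} (λ _ → refl) (λ _ → refl)
                  ; sym   = λ {z} {w} (a , b) → ≈-sym {re z} {re w} a , ≈-sym {im z} {im w} b
                  ; trans = λ {z} {w} {v} (a , b) (c , d) →
                      ≈-trans {re z} {re w} {re v} a c , ≈-trans {im z} {im w} {im v} b d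
                  }
                ; ∙-cong = λ {z} {z′} {w} {w′} (a , b) (c , d) →
                    +ᴿ-cong {re z} {re z′} {re w} {re w′} a c , +ᴿ-cong {im z} {im z′} {im w} {im w′} b d
                }
              ; assoc = λ x y z → ℝ-Ring.+-assoc (re x) (re y) (re z) , ℝ-Ring.+-assoc (im x) (im y) (im z)
              }
            ; identity = (λ z → ℝ-Ring.+-identityˡ (re z) , ℝ-Ring.+-identityˡ (im z))
                       , (λ z → ℝ-Ring.+-identityʳ (re z) , ℝ-Ring.+-identityʳ (im z))
            }
          ; inverse = (λ z → ℝ-Ring.-‿inverseˡ (re z) , ℝ-Ring.-‿inverseˡ (im z))
                    , (λ z → ℝ-Ring.-‿inverseʳ (re z) , ℝ-Ring.-‿inverseʳ (im z))
          ; ⁻¹-cong = λ {z} {w} (a , b) → -ᴿ-cong {re z} {re w} a , -ᴿ-cong {im z} {im w} b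
          }
        ; comm = λ z w → ℝ-Ring.+-comm (re z) (re w) , ℝ-Ring.+-comm (im z) (im w)
        }
      ; *-cong = λ {z} {z′} {w} {w′} → *ᶜ-cong {z} {z′} {w} {w′}
      ; *-assoc = λ x y z → pointwiseᶜ {(x *ᶜ y) *ᶜ z} {x *ᶜ (y *ᶜ z)}
          (λ k → assoc-re (seq (re x) k) (seq (im x) k) (seq (re y) k) (seq (im y) k) (seq (re z) k) (seq (im z) k))
          (λ k → assoc-im (seq (re x) k) (seq (im x) k) (seq (re y) k) (seq (im y) k) (seq (re z) k) (seq (im z) k))
      ; *-identity = (λ z → pointwiseᶜ {1ᶜ *ᶜ z} {z}
                       (λ k → idˡ-re (seq (re z) k) (seq (im z) k)) (λ k → idˡ-im (seq (re z) k) (seq (im z) k)))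
                   , (λ z → pointwiseᶜ {z *ᶜ 1ᶜ} {z}
                       (λ k → idʳ-re (seq (re z) k) (seq (im z) k)) (λ k → idʳ-im (seq (re z) k) (seq (im z) k)))
      ; distrib =
          (λ x y z → pointwiseᶜ {x *ᶜ (y +ᶜ z)} {x *ᶜ y +ᶜ x *ᶜ z}
            (λ k → distˡ-re (seq (re x) k) (seq (im x) k) (seq (re y) k) (seq (im y) k) (seq (re z) k) (seq (im z) k))
            (λ k → distˡ-im (seq (re x) k) (seq (im x) k) (seq (re y) k) (seq (im y) k) (seq (re z) k) (seq (im z) k)))
        , (λ x y z → pointwiseᶜ {(y +ᶜ z) *ᶜ x} {y *ᶜ x +ᶜ z *ᶜ x}
            (λ k → distʳ-re (seq (re x) k) (seq (im x) k) (seq (re y) k) (seq (im y) k) (seq (re z) k) (seq (im z) k))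
            (λ k → distʳ-im (seq (re x) k) (seq (im x) k) (seq (re y) k) (seq (im y) k) (seq (re z) k) (seq (im z) k)))
      }
    ; *-comm = λ z w → pointwiseᶜ {z *ᶜ w} {w *ᶜ z}
        (λ k → comm-re (seq (re z) k) (seq (im z) k) (seq (re w) k) (seq (im w) k))
        (λ k → comm-im (seq (re z) k) (seq (im z) k) (seq (re w) k) (seq (im w) k))
    }
  }
  where
  assoc-re : ∀ a b c d e f → (a * c - b * d) * e - (a * d + b * c) * f ≡ a * (c * e - d * f) - b * (c * f + d * e)
  assoc-re = solve 6 (λ a b c d e f → (a :* c :- b :* d) :* e :- (a :* d :+ b :* c) :* f
    := a :* (c :* e :- d :* f) :- b :* (c :* f :+ d :* e)) refl
  assoc-im : ∀ a b c d e f → (a * c - b * d) * f + (a * d + b * c) * e ≡ a * (c * f + d * e) + b * (c * e - d * f)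
  assoc-im = solve 6 (λ a b c d e f → (a :* c :- b :* d) :* f :+ (a :* d :+ b :* c) :* e
    := a :* (c :* f :+ d :* e) :+ b :* (c :* e :- d :* f)) refl
  idˡ-re : ∀ a b → 1ℚ * a - 0ℚ * b ≡ a
  idˡ-re = solve 2 (λ a b → con 1ℚ :* a :- con 0ℚ :* b := a) refl
  idˡ-im : ∀ a b → 1ℚ * b + 0ℚ * a ≡ b
  idˡ-im = solve 2 (λ a b → con 1ℚ :* b :+ con 0ℚ :* a := b) refl
  idʳ-re : ∀ a b → a * 1ℚ - b * 0ℚ ≡ a
  idʳ-re = solve 2 (λ a b → a :* con 1ℚ :- b :* con 0ℚ := a) refl
  idʳ-im : ∀ a b → a * 0ℚ + b * 1ℚ ≡ b
  idʳ-im = solve 2 (λ a b → a :* con 0ℚ :+ b :* con 1ℚ := b) refl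
  distˡ-re : ∀ a b c d e f → a * (c + e) - b * (d + f) ≡ (a * c - b * d) + (a * e - b * f)
  distˡ-re = solve 6 (λ a b c d e f → a :* (c :+ e) :- b :* (d :+ f)
    := (a :* c :- b :* d) :+ (a :* e :- b :* f)) refl
  distˡ-im : ∀ a b c d e f → a * (d + f) + b * (c + e) ≡ (a * d + b * c) + (a * f + b * e)
  distˡ-im = solve 6 (λ a b c d e f → a :* (d :+ f) :+ b :* (c :+ e)
    := (a :* d :+ b :* c) :+ (a :* f :+ b :* e)) refl
  distʳ-re : ∀ a b c d e f → (c + e) * a - (d + f) * b ≡ (c * a - d * b) + (e * a - f * b)
  distʳ-re = solve 6 (λ a b c d e f → (c :+ e) :* a :- (d :+ f) :* b
    := (c :* a :- d :* b) :+ (e :* a :- f :* b)) refl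
  distʳ-im : ∀ a b c d e f → (c + e) * b + (d + f) * a ≡ (c * b + d * a) + (e * b + f * a)
  distʳ-im = solve 6 (λ a b c d e f → (c :+ e) :* b :+ (d :+ f) :* a
    := (c :* b :+ d :* a) :+ (e :* b :+ f :* a)) refl
  comm-re : ∀ a b c d → a * c - b * d ≡ c * a - d * b
  comm-re = solve 4 (λ a b c d → a :* c :- b :* d := c :* a :- d :* b) refl
  comm-im : ∀ a b c d → a * d + b * c ≡ c * b + d * a
  comm-im = solve 4 (λ a b c d → a :* d :+ b :* c := c :* b :+ d :* a) refl

module ℂ-Ring = CommutativeRing ℂ-commutativeRing

-- Finite sums with few nonzero terms, used for complex matrix products and for real degrees

module SparseSum (R : CommutativeRing 0ℓ 0ℓ) where
  module R = CommutativeRing R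
  open SemiringSum R.semiring using (sum; sum-remove; sum-cong-≋; sum-replicate-zero; ∑-distrib-+)
  open import Relation.Binary.Reasoning.Setoid R.setoid

  sum-zero : ∀ {n} (f : Vector R.Carrier n) → (∀ j → f j R.≈ R.0#) → sum f R.≈ R.0#
  sum-zero {n} f f≈0 = R.trans (sum-cong-≋ f≈0) (sum-replicate-zero n)

  sum-single : ∀ {n} (f : Vector R.Carrier n) u → (∀ j → j ≢ u → f j R.≈ R.0#) → sum f R.≈ f u
  sum-single {suc n} f u f≈0 = begin
    sum f                              ≈⟨ sum-remove {i = u} f ⟩
    f u R.+ sum (λ j → f (punchIn u j))  ≈⟨ R.+-congˡ (sum-zero _ λ j → f≈0 (punchIn u j) (punchInᵢ≢i u j)) ⟩
    f u R.+ R.0#                       ≈⟨ R.+-identityʳ (f u) ⟩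
    f u                                ∎

  sum-pair : ∀ {n} (f : Vector R.Carrier n) {u v} → u ≢ v →
             (∀ j → j ≢ u → j ≢ v → f j R.≈ R.0#) → sum f R.≈ f u R.+ f v
  sum-pair {suc n} f {u} {v} u≢v f≈0 = begin
    sum f                                          ≈⟨ sum-remove {i = u} f ⟩
    f u R.+ sum (λ j → f (punchIn u j))            ≈⟨ R.+-congˡ (sum-single _ v′ off) ⟩
    f u R.+ f (punchIn u v′)                       ≡⟨ cong (λ w → f u R.+ f w) (punchIn-punchOut u≢v) ⟩
    f u R.+ f v                                    ∎
    where
    v′ = punchOut u≢v
    off : ∀ j → j ≢ v′ → f (punchIn u j) R.≈ R.0#
    off j j≢v′ = f≈0 (punchIn u j) (punchInᵢ≢i u j)
      λ e → j≢v′ (punchIn-injective u j v′ (trans e (sym (punchIn-punchOut u≢v))))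

  -- Made for comparing the rows of two twins, which agree outside the columns `u` and `v`.
  sum-differ : ∀ {n} (f g : Vector R.Carrier n) {u v} → u ≢ v → (∀ j → j ≢ u → j ≢ v → f j R.≈ g j) →
               sum f R.≈ sum g R.+ ((f u R.- g u) R.+ (f v R.- g v))
  sum-differ f g {u} {v} u≢v f≈g = begin
    sum f                                                 ≈⟨ sum-cong-≋ (λ j → R.sym (g+[f-g] j)) ⟩
    sum (λ j → g j R.+ (f j R.- g j))                     ≈⟨ ∑-distrib-+ g (λ j → f j R.- g j) ⟩
    sum g R.+ sum (λ j → f j R.- g j)                     ≈⟨ R.+-congˡ (sum-pair _ u≢v
      (λ j j≢u j≢v → R.trans (R.+-congʳ (f≈g j j≢u j≢v)) (R.-‿inverseʳ (g j)))) ⟩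
    sum g R.+ ((f u R.- g u) R.+ (f v R.- g v))           ∎
    where
    g+[f-g] : ∀ j → g j R.+ (f j R.- g j) R.≈ f j
    g+[f-g] j = begin
      g j R.+ (f j R.- g j)         ≈⟨ R.+-comm (g j) (f j R.- g j) ⟩
      f j R.- g j R.+ g j           ≈⟨ R.+-assoc (f j) (R.- g j) (g j) ⟩
      f j R.+ (R.- g j R.+ g j)     ≈⟨ R.+-congˡ (R.-‿inverseˡ (g j)) ⟩
      f j R.+ R.0#                  ≈⟨ R.+-identityʳ (f j) ⟩
      f j                           ∎

-- What the rows of A(X), L(X) and Q(X) at twin vertices u and v have in common.
record TwinRows {K : Set} (_~_ : K → K → Set) {n} (M : Matrix K n) (u v : Fin n) : Set where
  field
    diagonal : M u u ~ M v v
    swapped  : M u v ~ M v u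
    other    : ∀ j → j ≢ u → j ≢ v → M u j ~ M v j

open TwinRows

-- The exponential of a matrix with twin rows

module _ {n} (B : Matrix ℂ n) {u v : Fin n} (u≢v : u ≢ v) (tw : TwinRows _≈ᶜ_ B u v) where
  open ℂ-Ring using (+-cong; +-congˡ; +-congʳ; *-congʳ)
  open import Relation.Binary.Reasoning.Setoid ℂ-Ring.setoid

  -- e_u − e_v is a left eigenvector of B.
  twin-row-action : ∀ (x : Vector ℂ n) →
    (B ⊗ᵛ x) u -ᶜ (B ⊗ᵛ x) v ≈ᶜ (B u u -ᶜ B v u) *ᶜ (x u -ᶜ x v)
  twin-row-action x = begin
    (B ⊗ᵛ x) u -ᶜ s
      ≈⟨ +-congʳ { -ᶜ s} {(B ⊗ᵛ x) u} {s +ᶜ d} (SparseSum.sum-differ ℂ-commutativeRing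
           (λ l → B u l *ᶜ x l) (λ l → B v l *ᶜ x l) u≢v
           (λ j j≢u j≢v → *-congʳ {x j} {B u j} {B v j} (other tw j j≢u j≢v))) ⟩
    (s +ᶜ d) -ᶜ s
      ≈⟨ pointwiseᶜ {(s +ᶜ d) -ᶜ s} {d} (λ k → e₁ (seq (re s) k) (seq (re d) k))
                                        (λ k → e₁ (seq (im s) k) (seq (im d) k)) ⟩
    d
      -- Column `v` contributes `B u v -ᶜ B v v`, which the twin conditions turn into
      -- `B v u -ᶜ B u u`, the negative of the contribution of column `u`.
      ≈⟨ +-congˡ {B u u *ᶜ x u -ᶜ B v u *ᶜ x u} {B u v *ᶜ x v -ᶜ B v v *ᶜ x v} {B v u *ᶜ x v -ᶜ B u u *ᶜ x v}
           (+-cong {B u v *ᶜ x v} {B v u *ᶜ x v} { -ᶜ (B v v *ᶜ x v)} { -ᶜ (B u u *ᶜ x v)}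
             (*-congʳ {x v} {B u v} {B v u} (swapped tw))
             (ℂ-Ring.-‿cong {B v v *ᶜ x v} {B u u *ᶜ x v} (*-congʳ {x v} {B v v} {B u u}
               (ℂ-Ring.sym {B u u} {B v v} (diagonal tw))))) ⟩
    (B u u *ᶜ x u -ᶜ B v u *ᶜ x u) +ᶜ (B v u *ᶜ x v -ᶜ B u u *ᶜ x v)
      ≈⟨ pointwiseᶜ {(B u u *ᶜ x u -ᶜ B v u *ᶜ x u) +ᶜ (B v u *ᶜ x v -ᶜ B u u *ᶜ x v)}
           {(B u u -ᶜ B v u) *ᶜ (x u -ᶜ x v)}
           (λ k → e₂ (seq (re (B u u)) k) (seq (im (B u u)) k) (seq (re (B v u)) k) (seq (im (B v u)) k)
                     (seq (re (x u)) k) (seq (im (x u)) k) (seq (re (x v)) k) (seq (im (x v)) k))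
           (λ k → e₃ (seq (re (B u u)) k) (seq (im (B u u)) k) (seq (re (B v u)) k) (seq (im (B v u)) k)
                     (seq (re (x u)) k) (seq (im (x u)) k) (seq (re (x v)) k) (seq (im (x v)) k)) ⟩
    (B u u -ᶜ B v u) *ᶜ (x u -ᶜ x v) ∎
    where
    s d : ℂ
    s = (B ⊗ᵛ x) v
    d = (B u u *ᶜ x u -ᶜ B v u *ᶜ x u) +ᶜ (B u v *ᶜ x v -ᶜ B v v *ᶜ x v)
    e₁ : ∀ s d → (s + d) - s ≡ d
    e₁ = solve 2 (λ s d → (s :+ d) :- s := d) refl
    e₂ : ∀ a a′ b b′ x x′ y y′ →
      ((a * x - a′ * x′) - (b * x - b′ * x′)) + ((b * y - b′ * y′) - (a * y - a′ * y′))
      ≡ (a - b) * (x - y) - (a′ - b′) * (x′ - y′)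
    e₂ = solve 8 (λ a a′ b b′ x x′ y y′ →
      ((a :* x :- a′ :* x′) :- (b :* x :- b′ :* x′)) :+ ((b :* y :- b′ :* y′) :- (a :* y :- a′ :* y′))
      := (a :- b) :* (x :- y) :- (a′ :- b′) :* (x′ :- y′)) refl
    e₃ : ∀ a a′ b b′ x x′ y y′ →
      ((a * x′ + a′ * x) - (b * x′ + b′ * x)) + ((b * y′ + b′ * y) - (a * y′ + a′ * y))
      ≡ (a - b) * (x′ - y′) + (a′ - b′) * (x - y)
    e₃ = solve 8 (λ a a′ b b′ x x′ y y′ →
      ((a :* x′ :+ a′ :* x) :- (b :* x′ :+ b′ :* x)) :+ ((b :* y′ :+ b′ :* y) :- (a :* y′ :+ a′ :* y))
      := (a :- b) :* (x′ :- y′) :+ (a′ :- b′) :* (x :- y)) refl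

-- The powers of i y and the partial sums of e^{iy}, with the recursions of `power` and `expSum`, so
-- that they can be matched degree by degree with differences of matrix entries.
imagPower cisSum : ℝ → ℕ → ℂ
imagPower y zero    = 1ᶜ
imagPower y (suc k) = (0ᴿ +i y) *ᶜ imagPower y k
cisSum y zero    = 0ᶜ
cisSum y (suc N) = cisSum y N +ᶜ fromℝ (fromℚ (invFact N)) *ᶜ imagPower y N

-- Real arithmetic acts index by index, and `rePow` and `imPow` keep the factor `0ℚ` that the
-- product with 0 + i y produces, so the two recursions coincide literally.
re-imagPower : ∀ y k n → seq (re (imagPower y k)) n ≡ rePow (seq y n) k
im-imagPower : ∀ y k n → seq (im (imagPower y k)) n ≡ imPow (seq y n) k
re-imagPower y zero    n = refl
re-imagPower y (suc k) n = cong₂ (λ a b → 0ℚ * a - seq y n * b) (re-imagPower y k n) (im-imagPower y k n)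
im-imagPower y zero    n = refl
im-imagPower y (suc k) n = cong₂ (λ a b → 0ℚ * b + seq y n * a) (re-imagPower y k n) (im-imagPower y k n)

re-cisSum : ∀ y N n → seq (re (cisSum y N)) n ≡ cosSum (seq y n) N
re-cisSum y zero    n = refl
re-cisSum y (suc N) n = cong₂ _+_ (re-cisSum y N n) (trans
  (e (invFact N) (seq (re (imagPower y N)) n) (seq (im (imagPower y N)) n))
  (cong (_* invFact N) (re-imagPower y N n)))
  where
  e : ∀ f a b → f * a - 0ℚ * b ≡ a * f
  e = solve 3 (λ f a b → f :* a :- con 0ℚ :* b := a :* f) refl

im-cisSum : ∀ y N n → seq (im (cisSum y N)) n ≡ sinSum (seq y n) N
im-cisSum y zero    n = refl
im-cisSum y (suc N) n = cong₂ _+_ (im-cisSum y N n) (trans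
  (e (invFact N) (seq (re (imagPower y N)) n) (seq (im (imagPower y N)) n))
  (cong (_* invFact N) (im-imagPower y N n)))
  where
  e : ∀ f a b → f * b + 0ℚ * a ≡ b * f
  e = solve 3 (λ f a b → f :* b :+ con 0ℚ :* a := b :* f) refl

module _ {n} (B : Matrix ℂ n) {u v : Fin n} (u≢v : u ≢ v) (tw : TwinRows _≈ᶜ_ B u v)
         (y : ℝ) (eigenvalue : B u u -ᶜ B v u ≈ᶜ 0ᴿ +i y) where
  open ℂ-Ring using (+-cong; *-congˡ; *-cong)
  open import Relation.Binary.Reasoning.Setoid ℂ-Ring.setoid

  -- The row action applied to column `u` of the preceding power contributes one factor i y at each
  -- step; the identity matrix starts it with 1 - 0.
  power-twin : ∀ k → power B k u u -ᶜ power B k v u ≈ᶜ imagPower y k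
  power-twin zero
    rewrite dec-true (u Fin.≟ u) refl | dec-false (v Fin.≟ u) (u≢v ∘ sym) = pointwiseᶜ {1ᶜ -ᶜ 0ᶜ} {1ᶜ} (λ _ → refl) (λ _ → refl)
  power-twin (suc k) = begin
    power B (suc k) u u -ᶜ power B (suc k) v u
      ≈⟨ twin-row-action B u≢v tw (λ l → power B k l u) ⟩
    (B u u -ᶜ B v u) *ᶜ (power B k u u -ᶜ power B k v u)
      ≈⟨ *-cong {B u u -ᶜ B v u} {0ᴿ +i y} {power B k u u -ᶜ power B k v u} {imagPower y k}
           eigenvalue (power-twin k) ⟩
    imagPower y (suc k) ∎

  expSum-twin : ∀ N → expSum B N u u -ᶜ expSum B N v u ≈ᶜ cisSum y N
  expSum-twin zero    = pointwiseᶜ {0ᶜ -ᶜ 0ᶜ} {0ᶜ} (λ _ → refl) (λ _ → refl)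
  expSum-twin (suc N) = begin
    (s +ᶜ f *ᶜ p) -ᶜ (s′ +ᶜ f *ᶜ p′)
      ≈⟨ pointwiseᶜ {(s +ᶜ f *ᶜ p) -ᶜ (s′ +ᶜ f *ᶜ p′)} {(s -ᶜ s′) +ᶜ f *ᶜ (p -ᶜ p′)}
           (λ k → e₁ (invFact N) (seq (re s) k) (seq (re s′) k) (seq (re p) k) (seq (im p) k) (seq (re p′) k) (seq (im p′) k))
           (λ k → e₂ (invFact N) (seq (im s) k) (seq (im s′) k) (seq (re p) k) (seq (im p) k) (seq (re p′) k) (seq (im p′) k)) ⟩
    (s -ᶜ s′) +ᶜ f *ᶜ (p -ᶜ p′)
      ≈⟨ +-cong {s -ᶜ s′} {cisSum y N} {f *ᶜ (p -ᶜ p′)} {f *ᶜ imagPower y N} (expSum-twin N)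
           (*-congˡ {f} {p -ᶜ p′} {imagPower y N} (power-twin N)) ⟩
    cisSum y (suc N) ∎
    where
    s s′ f p p′ : ℂ
    s = expSum B N u u
    s′ = expSum B N v u
    f = fromℝ (fromℚ (invFact N))
    p = power B N u u
    p′ = power B N v u
    e₁ : ∀ f s t a b c d → (s + (f * a - 0ℚ * b)) - (t + (f * c - 0ℚ * d)) ≡ (s - t) + (f * (a - c) - 0ℚ * (b - d))
    e₁ = solve 7 (λ f s t a b c d → (s :+ (f :* a :- con 0ℚ :* b)) :- (t :+ (f :* c :- con 0ℚ :* d))
      := (s :- t) :+ (f :* (a :- c) :- con 0ℚ :* (b :- d))) refl
    e₂ : ∀ f s t a b c d → (s + (f * b + 0ℚ * a)) - (t + (f * d + 0ℚ * c)) ≡ (s - t) + (f * (b - d) + 0ℚ * (a - c))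
    e₂ = solve 7 (λ f s t a b c d → (s :+ (f :* b :+ con 0ℚ :* a)) :- (t :+ (f :* d :+ con 0ℚ :* c))
      := (s :- t) :+ (f :* (b :- d) :+ con 0ℚ :* (a :- c))) refl

-- Passage to the limit in the exponential series

lim-close : ∀ s (s-cauchy : IsCauchyᴿ s) {ε} → 0ℚ < ε →
  Eventually λ m → Eventually λ k → ∣ seq (s m) k - seq (lim s s-cauchy) k ∣ ≤ℚ ε
lim-close s s-cauchy {ε} 0<ε = map-eventually
  (λ m h → map-eventually (λ k h′ → ≤-trans h′ (≤-reflexive (half+half ε))) (h (½ * ε) (0<½* 0<ε)))
  (lim-converges s s-cauchy (½ * ε) (0<½* 0<ε))

-- The threshold for k may depend on m: first the partial sums are taken close to their limits, and
-- only then are the representing sequences compared at late indices.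
lim-difference : ∀ s s′ (s-cauchy : IsCauchyᴿ s) (s′-cauchy : IsCauchyᴿ s′) (c : ℕ → ℝ) →
  (∀ m → s m -ᴿ s′ m ≈ c m) → ∀ {ε} → 0ℚ < ε →
  Eventually λ m → Eventually λ k →
    ∣ seq (c m) k - (seq (lim s s-cauchy) k - seq (lim s′ s′-cauchy) k) ∣ ≤ℚ ε
lim-difference s s′ s-cauchy s′-cauchy c s-s′≈c {ε} 0<ε = zip-eventually
  (λ m a a′ → zip-eventually (λ k (p , q) r → combine (seq (c m) k) (seq (s m) k) (seq (s′ m) k) _ _ p q r)
    (zip-eventually (λ _ → _,_) a a′) (s-s′≈c m (½ * ε) (0<½* 0<ε)))
  (lim-close s s-cauchy 0<ε/4) (lim-close s′ s′-cauchy 0<ε/4)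
  where
  0<ε/4 : 0ℚ < ½ * (½ * ε)
  0<ε/4 = 0<½* (0<½* 0<ε)
  e₁ : ∀ c a a′ l l′ → c - (l - l′) ≡ (c - (a - a′)) + ((a - l) - (a′ - l′))
  e₁ = solve 5 (λ c a a′ l l′ → c :- (l :- l′) := (c :- (a :- a′)) :+ ((a :- l) :- (a′ :- l′))) refl
  e₂ : ∀ ε → ½ * ε + (½ * (½ * ε) + ½ * (½ * ε)) ≡ ε
  e₂ = solve 1 (λ ε → con ½ :* ε :+ (con ½ :* (con ½ :* ε) :+ con ½ :* (con ½ :* ε)) := ε) refl
  combine : ∀ c a a′ l l′ → ∣ a - l ∣ ≤ℚ ½ * (½ * ε) → ∣ a′ - l′ ∣ ≤ℚ ½ * (½ * ε) →
            ∣ (a - a′) - c ∣ ≤ℚ ½ * ε → ∣ c - (l - l′) ∣ ≤ℚ ε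
  combine c a a′ l l′ p q r = begin
    ∣ c - (l - l′) ∣                                 ≡⟨ cong ∣_∣ (e₁ c a a′ l l′) ⟩
    ∣ (c - (a - a′)) + ((a - l) - (a′ - l′)) ∣       ≤⟨ ∣p+q∣≤∣p∣+∣q∣ (c - (a - a′)) ((a - l) - (a′ - l′)) ⟩
    ∣ c - (a - a′) ∣ + ∣ (a - l) - (a′ - l′) ∣       ≤⟨ +-mono-≤
      (≤-trans (≤-reflexive (∣p-q∣≡∣q-p∣ c (a - a′))) r)
      (≤-trans (∣p-q∣≤∣p∣+∣q∣ (a - l) (a′ - l′)) (+-mono-≤ p q)) ⟩
    ½ * ε + (½ * (½ * ε) + ½ * (½ * ε))              ≡⟨ e₂ ε ⟩
    ε                                                ∎
    where open ≤-Reasoning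

-- Factor c² - x² as (2 x + (c - x)) (c - x). The cap `η ≤ℚ 1ℚ` bounds the first factor
-- independently of η, so the error is linear in η.
square-perturb : ∀ {c x η K} → 0ℚ ≤ℚ η → η ≤ℚ 1ℚ → ∣ x ∣ ≤ℚ K → ∣ c - x ∣ ≤ℚ η →
  c * c ≤ℚ x * x + (K + K + 1ℚ) * η
square-perturb {c} {x} {η} {K} 0≤η η≤1 x≤K c-x≤η = p-q≤r⇒p≤q+r {c * c} {x * x} (begin
  c * c - x * x             ≡⟨ e₁ c x ⟩
  (x + x + (c - x)) * (c - x)   ≤⟨ p≤∣p∣ ((x + x + (c - x)) * (c - x)) ⟩
  ∣ (x + x + (c - x)) * (c - x) ∣ ≤⟨ ∣p*q∣≤ (x + x + (c - x)) (c - x) 0≤η sum≤ c-x≤η ⟩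
  (K + K + 1ℚ) * η          ∎)
  where
  open ≤-Reasoning
  e₁ : ∀ c x → c * c - x * x ≡ (x + x + (c - x)) * (c - x)
  e₁ = solve 2 (λ c x → c :* c :- x :* x := (x :+ x :+ (c :- x)) :* (c :- x)) refl
  sum≤ : ∣ x + x + (c - x) ∣ ≤ℚ K + K + 1ℚ
  sum≤ = ≤-trans (∣p+q∣≤∣p∣+∣q∣ (x + x) (c - x))
    (+-mono-≤ (≤-trans (∣p+q∣≤∣p∣+∣q∣ x x) (+-mono-≤ x≤K x≤K)) (≤-trans c-x≤η η≤1))

small-factor : ∀ {c ε} → 0ℚ < c → 0ℚ < ε → ∃[ η ] (0ℚ < η × η ≤ℚ 1ℚ × c * η ≤ℚ ε)
small-factor {c} {ε} 0<c 0<ε with divide 0<ε 0<c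
... | δ , 0<δ , cδ≡ε with ≤-total δ 1ℚ
...   | inj₁ δ≤1 = δ , 0<δ , δ≤1 , ≤-reflexive cδ≡ε
...   | inj₂ 1≤δ = 1ℚ , 0<1 , ≤-refl , ≤-trans (mulˡ-≤ (<⇒≤ 0<c) 1≤δ) (≤-reflexive cδ≡ε)

-- The difference is e^{iy}.
exp-twin-modulus : ∀ {n} (B : Matrix ℂ n) {u v : Fin n} → u ≢ v → TwinRows _≈ᶜ_ B u v →
  ∀ y → B u u -ᶜ B v u ≈ᶜ 0ᴿ +i y → 1ᴿ ≤ᴿ ∣ exp B u u -ᶜ exp B v u ∣²
exp-twin-modulus B {u} {v} u≢v tw y eigenvalue ε 0<ε =
  -- One m serves all three estimates. Afterwards k runs freely, and the approximations of `y` stay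
  -- within the bound for which m was chosen. The error ε is spent as one half on truncation and one
  -- quarter on each of the real and imaginary parts.
  let m , (cs , cre) , cim = at-end (zip-eventually (λ _ → _,_) (zip-eventually (λ _ → _,_) cos²+sin² re-close) im-close)
  in zip-eventually (λ k a b → begin
      1ℚ
        ≤⟨ cs (seq y k) (y≤r k) ⟩
      cosSum (seq y k) m * cosSum (seq y k) m + sinSum (seq y k) m * sinSum (seq y k) m + ½ * ε
        ≤⟨ +-monoˡ-≤ (½ * ε) (+-mono-≤
             (perturb (re z) zre≤ k (cosSum (seq y k) m)
               (subst (λ c → ∣ c - seq (re z) k ∣ ≤ℚ η) (re-cisSum y m k) a))
             (perturb (im z) zim≤ k (sinSum (seq y k) m)
               (subst (λ c → ∣ c - seq (im z) k ∣ ≤ℚ η) (im-cisSum y m k) b))) ⟩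
      (seq (re z) k * seq (re z) k + ½ * (½ * ε)) + (seq (im z) k * seq (im z) k + ½ * (½ * ε)) + ½ * ε
        ≡⟨ regroup (seq (re z) k * seq (re z) k) (seq (im z) k * seq (im z) k) ε ⟩
      seq ∣ z ∣² k + ε ∎) cre cim
  where
  open ≤-Reasoning
  at-end : ∀ {P : ℕ → Set} → Eventually P → ∃[ m ] P m
  at-end (N , h) = N , h N ℕ.≤-refl
  z : ℂ
  z = exp B u u -ᶜ exp B v u
  bound-z : ∃[ c ] Boundᶜ c z
  bound-z = bound-exists z
  K : ℚ
  K = proj₁ bound-z
  zre≤ : Boundᴿ K (re z)
  zre≤ = proj₁ (proj₂ bound-z)
  zim≤ : Boundᴿ K (im z)
  zim≤ = proj₂ (proj₂ bound-z)
  0≤K : 0ℚ ≤ℚ K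
  0≤K = ≤-trans (0≤∣p∣ (seq (re z) 0)) (zre≤ 0)
  factor : ∃[ η ] (0ℚ < η × η ≤ℚ 1ℚ × (K + K + 1ℚ) * η ≤ℚ ½ * (½ * ε))
  factor = small-factor (<-≤-trans 0<1 (q≤p+q 1ℚ (0≤+ {K} 0≤K 0≤K))) (0<½* (0<½* 0<ε))
  η : ℚ
  η = proj₁ factor
  0<η : 0ℚ < η
  0<η = proj₁ (proj₂ factor)
  perturb : ∀ x → Boundᴿ K x → ∀ k c → ∣ c - seq x k ∣ ≤ℚ η → c * c ≤ℚ seq x k * seq x k + ½ * (½ * ε)
  perturb x x≤K k c h = ≤-trans
    (square-perturb {c} {seq x k} (<⇒≤ 0<η) (proj₁ (proj₂ (proj₂ factor))) (x≤K k) h)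
    (+-monoʳ-≤ (seq x k * seq x k) (proj₂ (proj₂ (proj₂ factor))))
  bound-y : ∃[ r ] (0ℚ < r × ∀ k → ∣ seq y k ∣ ≤ℚ r)
  bound-y = bounded (seq y) (cauchy y)
  y≤r : ∀ k → ∣ seq y k ∣ ≤ℚ proj₁ bound-y
  y≤r = proj₂ (proj₂ bound-y)
  cos²+sin² : Eventually λ m → ∀ q → ∣ q ∣ ≤ℚ proj₁ bound-y →
    1ℚ ≤ℚ cosSum q m * cosSum q m + sinSum q m * sinSum q m + ½ * ε
  cos²+sin² = 1≤cos²+sin² (<⇒≤ (proj₁ (proj₂ bound-y))) (0<½* 0<ε)
  re-close : Eventually λ m → Eventually λ k → ∣ seq (re (cisSum y m)) k - seq (re z) k ∣ ≤ℚ η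
  re-close = lim-difference (λ N → re (expSum B N u u)) (λ N → re (expSum B N v u))
    (proj₁ (exp-cauchy B u u)) (proj₁ (exp-cauchy B v u)) (λ m → re (cisSum y m))
    (λ m → proj₁ (expSum-twin B u≢v tw y eigenvalue m)) 0<η
  im-close : Eventually λ m → Eventually λ k → ∣ seq (im (cisSum y m)) k - seq (im z) k ∣ ≤ℚ η
  im-close = lim-difference (λ N → im (expSum B N u u)) (λ N → im (expSum B N v u))
    (proj₂ (exp-cauchy B u u)) (proj₂ (exp-cauchy B v u)) (λ m → im (cisSum y m))
    (λ m → proj₂ (expSum-twin B u≢v tw y eigenvalue m)) 0<η
  regroup : ∀ a b e → (a + ½ * (½ * e)) + (b + ½ * (½ * e)) + ½ * e ≡ a + b + e
  regroup = solve 3 (λ a b e → (a :+ con ½ :* (con ½ :* e)) :+ (b :+ con ½ :* (con ½ :* e)) :+ con ½ :* e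
    := a :+ b :+ e) refl

-- Scaling by i t preserves the twin conditions and, since M is real, makes the eigenvalue the
-- purely imaginary i t (M u u - M v u).
U-twin-modulus : ∀ {n} (M : Matrix ℝ n) {u v} → u ≢ v → TwinRows _≈_ M u v →
  ∀ t → 1ᴿ ≤ᴿ ∣ U M t u u -ᶜ U M t v u ∣²
U-twin-modulus M {u} {v} u≢v tw t = exp-twin-modulus B u≢v
  (record { diagonal = lift (M u u) (M v v) (diagonal tw) ; swapped = lift (M u v) (M v u) (swapped tw)
          ; other = λ j j≢u j≢v → lift (M u j) (M v j) (other tw j j≢u j≢v) })
  (t *ᴿ M u u -ᴿ t *ᴿ M v u)
  (pointwiseᶜ {B u u -ᶜ B v u} {0ᴿ +i (t *ᴿ M u u -ᴿ t *ᴿ M v u)}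
    (λ k → e₁ (seq (t *ᴿ M u u) k) (seq (t *ᴿ M v u) k))
    (λ k → e₂ (seq (t *ᴿ M u u) k) (seq (t *ᴿ M v u) k)))
  where
  B : Matrix ℂ _
  B i j = 𝕚 *ᶜ fromℝ (t *ᴿ M i j)
  lift : ∀ x y → x ≈ y → 𝕚 *ᶜ fromℝ (t *ᴿ x) ≈ᶜ 𝕚 *ᶜ fromℝ (t *ᴿ y)
  lift x y h = ℂ-Ring.*-congˡ {𝕚} {fromℝ (t *ᴿ x)} {fromℝ (t *ᴿ y)}
    (*ᴿ-congˡ t {x} {y} h , ℝ-Ring.refl {0ᴿ})
  e₁ : ∀ a b → (0ℚ * a - 1ℚ * 0ℚ) - (0ℚ * b - 1ℚ * 0ℚ) ≡ 0ℚ
  e₁ = solve 2 (λ a b → (con 0ℚ :* a :- con 1ℚ :* con 0ℚ) :- (con 0ℚ :* b :- con 1ℚ :* con 0ℚ) := con 0ℚ) refl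
  e₂ : ∀ a b → (0ℚ * 0ℚ + 1ℚ * a) - (0ℚ * 0ℚ + 1ℚ * b) ≡ a - b
  e₂ = solve 2 (λ a b → (con 0ℚ :* con 0ℚ :+ con 1ℚ :* a) :- (con 0ℚ :* con 0ℚ :+ con 1ℚ :* b) := a :- b) refl

-- Mixing and twin vertices

⊗ᵛ-𝐞 : ∀ {n} (B : Matrix ℂ n) (u w : Fin n) → (B ⊗ᵛ 𝐞 u) w ≈ᶜ B w u
⊗ᵛ-𝐞 B u w = ℂ-Ring.trans {(B ⊗ᵛ 𝐞 u) w} {B w u *ᶜ 𝐞 u u} {B w u}
  (SparseSum.sum-single ℂ-commutativeRing (λ k → B w k *ᶜ 𝐞 u k) u off) at-u
  where
  off : ∀ j → j ≢ u → B w j *ᶜ 𝐞 u j ≈ᶜ 0ᶜ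
  off j j≢u rewrite dec-false (u Fin.≟ j) (j≢u ∘ sym) = ℂ-Ring.zeroʳ (B w j)
  at-u : B w u *ᶜ 𝐞 u u ≈ᶜ B w u
  at-u rewrite dec-true (u Fin.≟ u) refl = ℂ-Ring.*-identityʳ (B w u)

re-*-conj : ∀ z → re (z *ᶜ conj z) ≈ ∣ z ∣²
re-*-conj z = pointwise {re (z *ᶜ conj z)} {∣ z ∣²} λ k → e (seq (re z) k) (seq (im z) k)
  where
  e : ∀ a b → a * a - b * (- b) ≡ a * a + b * b
  e = solve 2 (λ a b → a :* a :- b :* (:- b) := a :* a :+ b :* b) refl

probability : ∀ {n} (B : Matrix ℂ n) (u w : Fin n) →
  re (((B ⊗ᵛ 𝐞 u) ∘ᵛ (conjᵐ B ⊗ᵛ 𝐞 u)) w) ≈ ∣ B w u ∣²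
probability B u w = ≈-trans {re (p *ᶜ p′)} {re (B w u *ᶜ conj (B w u))} {∣ B w u ∣²}
  (proj₁ (*ᶜ-cong {p} {B w u} {p′} {conj (B w u)} (⊗ᵛ-𝐞 B u w) (⊗ᵛ-𝐞 (conjᵐ B) u w)))
  (re-*-conj (B w u))
  where
  p p′ : ℂ
  p = (B ⊗ᵛ 𝐞 u) w
  p′ = (conjᵐ B ⊗ᵛ 𝐞 u) w

0≤p² : ∀ p → 0ℚ ≤ℚ p * p
0≤p² p with ≤-total 0ℚ p
... | inj₁ 0≤p = 0≤* {p} 0≤p 0≤p
... | inj₂ p≤0 = ≤-trans (0≤* { - p} (neg-antimono-≤ p≤0) (neg-antimono-≤ p≤0))
  (≤-reflexive (solve 1 (λ p → (:- p) :* (:- p) := p :* p) refl p))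

0≤sumᴿ : ∀ {n} (f : Vector ℝ n) k → (∀ w → 0ℚ ≤ℚ seq (f w) k) → 0ℚ ≤ℚ seq (sumᴿ f) k
0≤sumᴿ {zero}  f k 0≤f = ≤-refl
0≤sumᴿ {suc n} f k 0≤f = 0≤+ {seq (f zero) k} (0≤f zero) (0≤sumᴿ (f ∘ suc) k (0≤f ∘ suc))

term≤sumᴿ : ∀ {n} (f : Vector ℝ n) k → (∀ w → 0ℚ ≤ℚ seq (f w) k) → ∀ w → seq (f w) k ≤ℚ seq (sumᴿ f) k
term≤sumᴿ f k 0≤f zero    = p≤p+q (seq (f zero) k) (0≤sumᴿ (f ∘ suc) k (0≤f ∘ suc))
term≤sumᴿ f k 0≤f (suc w) = ≤-trans (term≤sumᴿ (f ∘ suc) k (0≤f ∘ suc) w) (q≤p+q _ (0≤f zero))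

-- Bisection gives x < (root + width)² at every index. The width tends to zero, so it eventually
-- fits into the gap `ε′` that witnesses the strict inequality.
sqrt<⇒<² : ∀ x {ε} → sqrt x <ᴿ fromℚ ε → Eventually λ k → seq x k < ε * ε
sqrt<⇒<² x {ε} (ε′ , 0<ε′ , h) =
  let c , 0<c , x≤c = bounded (seq x) (cauchy x)
  in zip-eventually (λ k root≤ width≤ → <-≤-trans (root-upper (seq x k) k)
       (square-mono (0≤+ {root (seq x k) k} (0≤root (seq x k) k) (0≤width (seq x k) k))
         (≤-trans (+-monoʳ-≤ (root (seq x k) k) (≤-trans (mulʳ-≤ (<⇒≤ (0<2⁻^ k)) (+-monoˡ-≤ 1ℚ (x≤c k))) width≤))
           root≤)))
     h (c2⁻^→0 (c + 1ℚ) (0≤+ {c} (<⇒≤ 0<c) (<⇒≤ 0<1)) 0<ε′)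
  where
  square-mono : ∀ {p q} → 0ℚ ≤ℚ p → p ≤ℚ q → p * p ≤ℚ q * q
  square-mono 0≤p p≤q = mul-≤ 0≤p (≤-trans 0≤p p≤q) p≤q p≤q

-- At each index the square of one real part is at most the whole sum of squares under the root, as
-- squares of rationals are nonnegative.
norm<⇒re< : ∀ {n} (x : Vector ℂ n) {ε} → 0ℚ < ε → ‖ x ‖ <ᴿ fromℚ ε → ∀ w → Eventually λ k → seq (re (x w)) k < ε
norm<⇒re< x {ε} 0<ε h w = map-eventually
  (λ k s<ε² → square-cancel-< {seq (re (x w)) k} (<⇒≤ 0<ε) (≤-<-trans (≤-trans
    (p≤p+q (seq (re (x w)) k * seq (re (x w)) k) (0≤p² (seq (im (x w)) k)))
    (term≤sumᴿ (λ v → ∣ x v ∣²) k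
      (λ v → 0≤+ {seq (re (x v)) k * seq (re (x v)) k} (0≤p² (seq (re (x v)) k)) (0≤p² (seq (im (x v)) k))) w))
    s<ε²))
  (sqrt<⇒<² (sumᴿ λ v → ∣ x v ∣²) h)

-- The time is chosen before the vertex `w`, so a single τ bounds the entries at `u` and at its twin
-- together. The upper side of the closeness to 1/n is the one that the final inequality consumes.
mixing-probability : ∀ {n} (M : Matrix ℝ n) (u : Fin n) → LocalUniformMixing M u → ∀ {ε} → 0ℚ < ε →
  ∃[ τ ] (∀ w → ∣ U M τ w u ∣² ≤ᴿ fromℚ ((ℤ.+ 1 / n) {{nonZeroIndex u}} + ε))
mixing-probability {n} M u mixing {ε} 0<ε =
  let τ , h = mixing (fromℚ ε) (ε , 0<ε , 0 , λ _ _ → ≤-reflexive (+-identityˡ ε))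
      V = U M τ
      x = (V ⊗ᵛ 𝐞 u) ∘ᵛ (conjᵐ V ⊗ᵛ 𝐞 u)
  in τ , λ w δ 0<δ → zip-eventually
    (λ k re<ε close → combine (seq (re (x w)) k) (seq ∣ V w u ∣² k) δ (<⇒≤ re<ε) close)
    (norm<⇒re< (x -ᵛ uniform u) 0<ε h w) (probability V u w δ 0<δ)
  where
  1/n : ℚ
  1/n = (ℤ.+ 1 / n) {{nonZeroIndex u}}
  combine : ∀ p q δ → p - 1/n ≤ℚ ε → ∣ p - q ∣ ≤ℚ δ → q ≤ℚ 1/n + ε + δ
  combine p q δ p≤ h = ≤-trans
    (p-q≤r⇒p≤q+r {q} {p} (≤-trans (p≤∣p∣ (q - p)) (≤-trans (≤-reflexive (∣p-q∣≡∣q-p∣ q p)) h)))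
    (+-monoˡ-≤ δ (p-q≤r⇒p≤q+r {p} {1/n} p≤))

-- Twin vertices in the adjacency, degree and Laplacian matrices

module _ {n} (X : WeightedGraph n) {u v : Fin n} (twins : Twins X u v) where
  open WeightedGraph X

  private
    A D : Matrix ℝ n
    A = adjacencyMatrix X
    D = degreeMatrix X
    u≢v : u ≢ v
    u≢v = proj₁ twins

  -- The diagonal entries vanish because there are no loops, the swapped entries agree by symmetry
  -- of the weights, whether or not the twins are adjacent, and the remaining ones agree by the twin
  -- condition.
  adjacency-twinRows : TwinRows _≈_ A u v
  adjacency-twinRows = record { diagonal = diag ; swapped = swap ; other = off }
    where
    u⇒v : ∀ {j} → Adj u j → j ≢ v → Adj v j
    u⇒v uj j≢v = proj₁ (proj₁ (proj₁ (proj₂ twins)) (uj , j≢v ∘ sym))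
    v⇒u : ∀ {j} → Adj v j → j ≢ u → Adj u j
    v⇒u vj j≢u = proj₁ (proj₂ (proj₁ (proj₂ twins)) (vj , j≢u ∘ sym))
    diag : A u u ≈ A v v
    diag rewrite dec-false (Adj? u u) Adj-irrefl | dec-false (Adj? v v) Adj-irrefl = ℝ-Ring.refl {0ᴿ}
    swap : A u v ≈ A v u
    swap with Adj? u v
    ... | yes uv rewrite dec-true (Adj? v u) (Adj-sym uv) = weight-sym uv
    ... | no ¬uv rewrite dec-false (Adj? v u) (¬uv ∘ Adj-sym) = ℝ-Ring.refl {0ᴿ}
    off : ∀ j → j ≢ u → j ≢ v → A u j ≈ A v j
    off j j≢u j≢v with Adj? u j
    ... | yes uj rewrite dec-true (Adj? v j) (u⇒v uj j≢v) = proj₂ (proj₂ twins) j j≢u j≢v uj (u⇒v uj j≢v)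
    ... | no ¬uj rewrite dec-false (Adj? v j) (λ vj → ¬uj (v⇒u vj j≢u)) = ℝ-Ring.refl {0ᴿ}

  -- Degrees are row sums of A. The two rows differ at most in the columns `u` and `v`, and there
  -- the differences cancel.
  twin-degrees : degree X u ≈ degree X v
  twin-degrees = begin
    degree X u
      ≈⟨ SparseSum.sum-differ ℝ-commutativeRing (A u) (A v) u≢v (other adjacency-twinRows) ⟩
    degree X v +ᴿ ((A u u -ᴿ A v u) +ᴿ (A u v -ᴿ A v v))
      ≈⟨ ℝ-Ring.+-congˡ {degree X v} {(A u u -ᴿ A v u) +ᴿ (A u v -ᴿ A v v)} {(A v v -ᴿ A u v) +ᴿ (A u v -ᴿ A v v)}
           (ℝ-Ring.+-congʳ {A u v -ᴿ A v v} {A u u -ᴿ A v u} {A v v -ᴿ A u v}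
             (ℝ-Ring.+-cong {A u u} {A v v} { -ᴿ A v u} { -ᴿ A u v} (diagonal adjacency-twinRows)
               (-ᴿ-cong {A v u} {A u v} (≈-sym {A u v} {A v u} (swapped adjacency-twinRows))))) ⟩
    degree X v +ᴿ ((A v v -ᴿ A u v) +ᴿ (A u v -ᴿ A v v))
      ≈⟨ pointwise {degree X v +ᴿ ((A v v -ᴿ A u v) +ᴿ (A u v -ᴿ A v v))} {degree X v}
           (λ k → e (seq (degree X v) k) (seq (A v v) k) (seq (A u v) k)) ⟩
    degree X v ∎
    where
    open import Relation.Binary.Reasoning.Setoid ℝ-Ring.setoid
    e : ∀ d a b → d + ((a - b) + (b - a)) ≡ d
    e = solve 3 (λ d a b → d :+ ((a :- b) :+ (b :- a)) := d) refl

  degree-twinRows : TwinRows _≈_ D u v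
  degree-twinRows = record { diagonal = diag ; swapped = swap ; other = off }
    where
    diag : D u u ≈ D v v
    diag rewrite dec-true (u Fin.≟ u) refl | dec-true (v Fin.≟ v) refl = twin-degrees
    swap : D u v ≈ D v u
    swap rewrite dec-false (u Fin.≟ v) u≢v | dec-false (v Fin.≟ u) (u≢v ∘ sym) = ℝ-Ring.refl {0ᴿ}
    off : ∀ j → j ≢ u → j ≢ v → D u j ≈ D v j
    off j j≢u j≢v rewrite dec-false (u Fin.≟ j) (j≢u ∘ sym) | dec-false (v Fin.≟ j) (j≢v ∘ sym) = ℝ-Ring.refl {0ᴿ}

  laplacian-twinRows : TwinRows _≈_ (laplacian X) u v
  laplacian-twinRows = record
    { diagonal = minus u u v v (diagonal degree-twinRows) (diagonal adjacency-twinRows)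
    ; swapped  = minus u v v u (swapped degree-twinRows) (swapped adjacency-twinRows)
    ; other    = λ j j≢u j≢v → minus u j v j (other degree-twinRows j j≢u j≢v) (other adjacency-twinRows j j≢u j≢v)
    }
    where
    minus : ∀ a b c d → D a b ≈ D c d → A a b ≈ A c d → D a b -ᴿ A a b ≈ D c d -ᴿ A c d
    minus a b c d h h′ = +ᴿ-cong {D a b} {D c d} { -ᴿ A a b} { -ᴿ A c d} h (-ᴿ-cong {A a b} {A c d} h′)

  signlessLaplacian-twinRows : TwinRows _≈_ (signlessLaplacian X) u v
  signlessLaplacian-twinRows = record
    { diagonal = plus u u v v (diagonal degree-twinRows) (diagonal adjacency-twinRows)
    ; swapped  = plus u v v u (swapped degree-twinRows) (swapped adjacency-twinRows)
    ; other    = λ j j≢u j≢v → plus u j v j (other degree-twinRows j j≢u j≢v) (other adjacency-twinRows j j≢u j≢v)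
    }
    where
    plus : ∀ a b c d → D a b ≈ D c d → A a b ≈ A c d → D a b +ᴿ A a b ≈ D c d +ᴿ A c d
    plus a b c d h h′ = +ᴿ-cong {D a b} {D c d} {A a b} {A c d} h h′

  graph-matrix-twinRows : ∀ {M} → M ∈ adjacencyMatrix X ∷ laplacian X ∷ signlessLaplacian X ∷ [] → TwinRows _≈_ M u v
  graph-matrix-twinRows (here refl)                 = adjacency-twinRows
  graph-matrix-twinRows (there (here refl))         = laplacian-twinRows
  graph-matrix-twinRows (there (there (here refl))) = signlessLaplacian-twinRows

-- The contradiction for five or more vertices

∣z-w∣²≤ : ∀ a b c d → (a - c) * (a - c) + (b - d) * (b - d) ≤ℚ ((a * a + b * b) + (c * c + d * d)) + ((a * a + b * b) + (c * c + d * d))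
-- Parallelogram law: the added nonnegative term is ∣z + w∣².
∣z-w∣²≤ a b c d = ≤-trans (p≤p+q ((a - c) * (a - c) + (b - d) * (b - d))
    (0≤+ {(a + c) * (a + c)} (0≤p² (a + c)) (0≤p² (b + d))))
  (≤-reflexive (e a b c d))
  where
  e : ∀ a b c d → (a - c) * (a - c) + (b - d) * (b - d) + ((a + c) * (a + c) + (b + d) * (b + d))
      ≡ ((a * a + b * b) + (c * c + d * d)) + ((a * a + b * b) + (c * c + d * d))
  e = solve 4 (λ a b c d → (a :- c) :* (a :- c) :+ (b :- d) :* (b :- d) :+ ((a :+ c) :* (a :+ c) :+ (b :+ d) :* (b :+ d))
      := ((a :* a :+ b :* b) :+ (c :* c :+ d :* d)) :+ ((a :* a :+ b :* b) :+ (c :* c :+ d :* d))) refl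

1/-antimono : ∀ {m n} .{{_ : ℕ.NonZero m}} .{{_ : ℕ.NonZero n}} → m ≤ n → ℤ.+ 1 / n ≤ℚ ℤ.+ 1 / m
1/-antimono {suc m} {suc n} m≤n = toℚᵘ-cancel-≤
  (ℚᵘ.≤-respˡ-≃ (ℚᵘ.≃-sym (toℚᵘ-fromℚᵘ (mkℚᵘ (ℤ.+ 1) n)))
    (ℚᵘ.≤-respʳ-≃ (ℚᵘ.≃-sym (toℚᵘ-fromℚᵘ (mkℚᵘ (ℤ.+ 1) m)))
      (*≤* (ℤ.*-monoˡ-≤-nonNeg (ℤ.+ 1) (ℤ.+≤+ m≤n)))))

twinRows-mixing : ∀ {n} (M : Matrix ℝ n) {u v : Fin n} → u ≢ v → TwinRows _≈_ M u v →
  LocalUniformMixing M u → ¬ (5 ≤ n)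
twinRows-mixing {n} M {u} {v} u≢v tw mixing 5≤n =
  let τ , p≤ = mixing-probability M u mixing 0<ε
      a = U M τ u u
      b = U M τ v u
      K , h = zip-eventually (λ k lower (pᵤ , pᵥ) → begin
          1ℚ
            ≤⟨ lower ⟩
          seq ∣ a -ᶜ b ∣² k + ε
            ≤⟨ +-monoˡ-≤ ε (∣z-w∣²≤ (seq (re a) k) (seq (im a) k) (seq (re b) k) (seq (im b) k)) ⟩
          (seq ∣ a ∣² k + seq ∣ b ∣² k) + (seq ∣ a ∣² k + seq ∣ b ∣² k) + ε
            ≤⟨ +-monoˡ-≤ ε (+-mono-≤ (+-mono-≤ (to-1/5 pᵤ) (to-1/5 pᵥ)) (+-mono-≤ (to-1/5 pᵤ) (to-1/5 pᵥ))) ⟩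
          bound ∎)
        (U-twin-modulus M u≢v tw τ ε 0<ε)
        (zip-eventually (λ _ → _,_) (p≤ u ε 0<ε) (p≤ v ε 0<ε))
  in contradiction (h K ℕ.≤-refl) (from-no (1ℚ ≤? bound))
  where
  open ≤-Reasoning
  1/5 ε bound : ℚ
  1/5 = ℤ.+ 1 / 5
  -- Each of the four probabilities in `bound` carries one ε from mixing and one from the slack in
  -- `_≤ᴿ_`; the last ε is the slack in the modulus estimate. The nine together must stay below 1 -
  -- 4/5, and 1/50 makes `bound` equal to 49/50.
  ε = ℤ.+ 1 / 50
  bound = ((1/5 + ε + ε) + (1/5 + ε + ε)) + ((1/5 + ε + ε) + (1/5 + ε + ε)) + ε
  0<ε : 0ℚ < ε
  0<ε = positive⁻¹ ε
  to-1/5 : ∀ {p} → p ≤ℚ (ℤ.+ 1 / n) {{nonZeroIndex u}} + ε + ε → p ≤ℚ 1/5 + ε + ε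
  to-1/5 h = ≤-trans h (+-monoˡ-≤ ε (+-monoˡ-≤ ε (1/-antimono {5} {n} {{_}} {{nonZeroIndex u}} 5≤n)))

corollary12 : (n : ℕ) (X : WeightedGraph n) (u : Fin n) → HasTwin X u →
    (M : Matrix ℝ n) → M ∈ adjacencyMatrix X ∷ laplacian X ∷ signlessLaplacian X ∷ [] →
    LocalUniformMixing M u → n ≤ 4
corollary12 n X u (v , twins) M M∈ mixing =
  ℕ.≮⇒≥ (twinRows-mixing M (proj₁ twins) (graph-matrix-twinRows X twins M∈) mixing)
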